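{- Let $\nu,k$ be integers with $2\nu-1\ge k\ge\nu-1\ge1$. Then $x=0$ is a zero of the polynomial $D(2\nu,k,x)$ of multiplicity exactly $N(2\nu,k)$.
   Context: For $n>k\ge1$ and $x\in\mathbb{R}$, $A(n,k,x)$ is the $n\times n$ skew-symmetric Toeplitz matrix whose first $k$ superdiagonals have all entries $1$ and whose remaining superdiagonal entries are all $-x$; $D(n,k,x)\in\mathbb{Z}[x]$ is its determinant. $N(n,k)$ is the nullity of $A(n,k,0)$. -}

module Defs where

open import Algebra.Bundles using (RawRing; CommutativeRing)
import Algebra.Definitions.RawSemiring as RawSemiringDefs
import Algebra.Properties.Ring as RingProperties
import Algebra.Properties.Semiring.Sum as SemiringSum
open import Data.Bool.Base using (if_then_else_)
open import Data.Fin.Base using (Fin; zero; suc; toℕ; punchIn)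
open import Data.Fin.Properties using (all?; ¬∀⟶∃¬)
open import Data.Integer.Base as ℤ using (ℤ)
open import Data.List.Base using (List; []; _∷_; map)
open import Data.Nat.Base using (ℕ; zero; suc; _∸_; _<ᵇ_; _≤ᵇ_)
open import Data.Product.Base using (Σ; ∃-syntax; _×_; _,_; proj₁)
open import Data.Rational.Base as ℚ using (ℚ; 0ℚ; 1ℚ)
import Data.Rational.Properties as ℚₚ
open import Data.Vec.Functional using (Vector; head; tail; removeAt; insertAt)
open import Data.Vec.Functional.Properties using (insertAt-lookup; insertAt-punchIn)
open import Level using (0ℓ)
open import Relation.Binary.PropositionalEquality using (_≡_; _≗_; refl; sym; trans; cong; cong₂; module ≡-Reasoning)
open import Relation.Nullary using (¬_; yes; no)

Matrix : ∀ {a} → Set a → ℕ → ℕ → Set a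
Matrix R m n = Vector (Vector R n) m

module _ {c ℓ} (R : RawRing c ℓ) where
  open RawRing R
  open RawSemiringDefs rawSemiring using (sum; _^_)

  -- Laplace expansion along the first row.
  det : ∀ {n} → Matrix Carrier n n → Carrier
  det {zero}  M = 1#
  det {suc n} M =
    sum λ j → (- 1#) ^ toℕ j * M zero j * det (λ i l → M (suc i) (punchIn j l))

  A : (n k : ℕ) → Carrier → Matrix Carrier n n
  A n k x i j =
    if toℕ i <ᵇ toℕ j then superdiagonal (toℕ j ∸ toℕ i)
    else if toℕ j <ᵇ toℕ i then - superdiagonal (toℕ i ∸ toℕ j)
    else 0#
    where
    superdiagonal : ℕ → Carrier
    superdiagonal d = if d ≤ᵇ k then 1# else - x

------------------------------------------------------------------------
-- ℤ[X], as lists of coefficients with the constant term first.  Trailing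
-- zeros are allowed, so polynomials are compared coefficientwise.

Poly : Set
Poly = List ℤ

coeff : Poly → ℕ → ℤ
coeff []      _       = ℤ.0ℤ
coeff (a ∷ p) zero    = a
coeff (a ∷ p) (suc i) = coeff p i

infixl 6 _+ₚ_
infixl 7 _*ₚ_

_+ₚ_ : Poly → Poly → Poly
[]      +ₚ q       = q
(a ∷ p) +ₚ []      = a ∷ p
(a ∷ p) +ₚ (b ∷ q) = (a ℤ.+ b) ∷ (p +ₚ q)

_*ₚ_ : Poly → Poly → Poly
[]      *ₚ q = []
(a ∷ p) *ₚ q = map (a ℤ.*_) q +ₚ (ℤ.0ℤ ∷ (p *ₚ q))

ℤ[X] : RawRing 0ℓ 0ℓ
ℤ[X] = record
  { Carrier = Poly
  ; _≈_     = λ p q → coeff p ≗ coeff q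
  ; _+_     = _+ₚ_
  ; _*_     = _*ₚ_
  ; -_      = map (ℤ.-_)
  ; 0#      = []
  ; 1#      = ℤ.1ℤ ∷ []
  }

X : Poly
X = ℤ.0ℤ ∷ ℤ.1ℤ ∷ []

X-_ : ℤ → Poly
X- a = (ℤ.- a) ∷ ℤ.1ℤ ∷ []

-- For m = 0 this says that a is not a zero of p; it never holds for p = 0.
IsZeroOfMultiplicity : Poly → ℤ → ℕ → Set
IsZeroOfMultiplicity p a m = (X- a) ^ m ∣ p × (X- a) ^ suc m ∤ p
  where open RawSemiringDefs (RawRing.rawSemiring ℤ[X]) using (_^_; _∣_; _∤_)

D : (n k : ℕ) → Poly
D n k = det ℤ[X] (A ℤ[X] n k X)

------------------------------------------------------------------------
-- Nullity of rational matrices: the number of vectors in a basis of the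
-- kernel, which is constructed by imposing one row at a time.

open SemiringSum (CommutativeRing.semiring ℚₚ.+-*-commutativeRing)
  using (sum; sum-cong-≗; sum-remove; sum-replicate-zero; ∑-distrib-+; ∑-comm; *-distribˡ-sum; *-distribʳ-sum)
open RingProperties (CommutativeRing.ring ℚₚ.+-*-commutativeRing)
  using (-‿distribˡ-*; -‿distribʳ-*; +-inverseˡ-unique)

infix 8 _∙_

_∙_ : ∀ {n} → Vector ℚ n → Vector ℚ n → ℚ
u ∙ v = sum λ j → u j ℚ.* v j

linComb : ∀ {d n} → Vector ℚ d → (Fin d → Vector ℚ n) → Vector ℚ n
linComb c b j = sum λ i → c i ℚ.* b i j

Kernel : ∀ {m n} → Matrix ℚ m n → Vector ℚ n → Set
Kernel M v = ∀ i → M i ∙ v ≡ 0ℚ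

record IsBasis {d n} (V : Vector ℚ n → Set) (b : Fin d → Vector ℚ n) : Set where
  field
    member      : ∀ i → V (b i)
    independent : ∀ c → (∀ j → linComb c b j ≡ 0ℚ) → ∀ i → c i ≡ 0ℚ
    spanning    : ∀ v → V v → ∃[ c ] linComb c b ≗ v

HasDimension : ∀ {n} → (Vector ℚ n → Set) → ℕ → Set
HasDimension {n} V d = Σ (Fin d → Vector ℚ n) (IsBasis V)

private

  ∙-congʳ : ∀ {n} (r : Vector ℚ n) {u v : Vector ℚ n} → u ≗ v → r ∙ u ≡ r ∙ v
  ∙-congʳ r u≗v = sum-cong-≗ λ j → cong (r j ℚ.*_) (u≗v j)

  swap* : ∀ a b c → a ℚ.* (b ℚ.* c) ≡ b ℚ.* (a ℚ.* c)
  swap* a b c = trans (sym (ℚₚ.*-assoc a b c))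
    (trans (cong (ℚ._* c) (ℚₚ.*-comm a b)) (ℚₚ.*-assoc b a c))

  ∙-linComb : ∀ {d n} (r : Vector ℚ n) (c : Vector ℚ d) (b : Fin d → Vector ℚ n) →
              r ∙ linComb c b ≡ sum (λ i → c i ℚ.* r ∙ b i)
  ∙-linComb r c b = begin
    sum (λ j → r j ℚ.* sum (λ i → c i ℚ.* b i j))
      ≡⟨ sum-cong-≗ (λ j → *-distribˡ-sum (r j) (λ i → c i ℚ.* b i j)) ⟩
    sum (λ j → sum (λ i → r j ℚ.* (c i ℚ.* b i j)))
      ≡⟨ ∑-comm (λ j i → r j ℚ.* (c i ℚ.* b i j)) ⟩
    sum (λ i → sum (λ j → r j ℚ.* (c i ℚ.* b i j)))
      ≡⟨ sum-cong-≗ (λ i → sum-cong-≗ (λ j → swap* (r j) (c i) (b i j))) ⟩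
    sum (λ i → sum (λ j → c i ℚ.* (r j ℚ.* b i j)))
      ≡⟨ sum-cong-≗ (λ i → *-distribˡ-sum (c i) (λ j → r j ℚ.* b i j)) ⟨
    sum (λ i → c i ℚ.* r ∙ b i) ∎
    where open ≡-Reasoning

  δ : ∀ {n} → Fin n → Vector ℚ n
  δ zero    zero    = 1ℚ
  δ zero    (suc j) = 0ℚ
  δ (suc i) zero    = 0ℚ
  δ (suc i) (suc j) = δ i j

  sum-zero : ∀ {n} (f : Vector ℚ n) → (∀ i → f i ≡ 0ℚ) → sum f ≡ 0ℚ
  sum-zero {n} f f≡0 = trans (sum-cong-≗ f≡0) (sum-replicate-zero n)

  linComb-δ : ∀ {n} (c : Vector ℚ n) → linComb c δ ≗ c
  linComb-δ c zero = trans
    (cong₂ ℚ._+_ (ℚₚ.*-identityʳ (c zero))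
      (sum-zero (λ i → c (suc i) ℚ.* 0ℚ) (λ i → ℚₚ.*-zeroʳ (c (suc i)))))
    (ℚₚ.+-identityʳ (c zero))
  linComb-δ c (suc j) = trans
    (cong₂ ℚ._+_ (ℚₚ.*-zeroʳ (c zero)) (linComb-δ (tail c) j))
    (ℚₚ.+-identityˡ (c (suc j)))

  module Pivot {m n d} (M : Matrix ℚ (suc m) n) (b : Fin (suc d) → Vector ℚ n)
               (B : IsBasis (Kernel (tail M)) b)
               (p : Fin (suc d)) (c≢0 : ¬ (head M ∙ b p ≡ 0ℚ)) where
    open IsBasis B
    open ≡-Reasoning

    r : Vector ℚ n
    r = head M

    c : Vector ℚ (suc d)
    c i = r ∙ b i

    instance
      c-nonZero : ℚ.NonZero (c p)
      c-nonZero = ℚ.≢-nonZero c≢0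

    t : Vector ℚ d
    t j = c (punchIn p j) ℚ.* ℚ.1/ c p

    b′ : Fin d → Vector ℚ n
    b′ j l = b (punchIn p j) l ℚ.+ (ℚ.- t j) ℚ.* b p l

    s : Vector ℚ d → ℚ
    s e = sum λ j → e j ℚ.* (ℚ.- t j)

    split : ∀ (f : Vector ℚ (suc d)) (l : Fin n) →
            linComb f b l ≡ f p ℚ.* b p l ℚ.+ sum (λ j → f (punchIn p j) ℚ.* b (punchIn p j) l)
    split f l = sum-remove {i = p} (λ i → f i ℚ.* b i l)

    linComb-b′ : ∀ e → linComb e b′ ≗ linComb (insertAt e p (s e)) b
    linComb-b′ e l = begin
      sum (λ j → e j ℚ.* (b (punchIn p j) l ℚ.+ (ℚ.- t j) ℚ.* b p l))
        ≡⟨ sum-cong-≗ (λ j → trans (ℚₚ.*-distribˡ-+ (e j) _ _)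
             (cong (e j ℚ.* b (punchIn p j) l ℚ.+_) (sym (ℚₚ.*-assoc (e j) _ _)))) ⟩
      sum (λ j → e j ℚ.* b (punchIn p j) l ℚ.+ e j ℚ.* (ℚ.- t j) ℚ.* b p l)
        ≡⟨ ∑-distrib-+ (λ j → e j ℚ.* b (punchIn p j) l) (λ j → e j ℚ.* (ℚ.- t j) ℚ.* b p l) ⟩
      sum (λ j → e j ℚ.* b (punchIn p j) l) ℚ.+ sum (λ j → e j ℚ.* (ℚ.- t j) ℚ.* b p l)
        ≡⟨ cong (sum (λ j → e j ℚ.* b (punchIn p j) l) ℚ.+_)
             (*-distribʳ-sum (b p l) (λ j → e j ℚ.* (ℚ.- t j))) ⟨
      sum (λ j → e j ℚ.* b (punchIn p j) l) ℚ.+ s e ℚ.* b p l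
        ≡⟨ ℚₚ.+-comm _ (s e ℚ.* b p l) ⟩
      s e ℚ.* b p l ℚ.+ sum (λ j → e j ℚ.* b (punchIn p j) l)
        ≡⟨ cong₂ ℚ._+_ (cong (ℚ._* b p l) (insertAt-lookup e p (s e)))
             (sum-cong-≗ (λ j → cong (ℚ._* b (punchIn p j) l) (insertAt-punchIn e p (s e) j))) ⟨
      insertAt e p (s e) p ℚ.* b p l
        ℚ.+ sum (λ j → insertAt e p (s e) (punchIn p j) ℚ.* b (punchIn p j) l)
        ≡⟨ split (insertAt e p (s e)) l ⟨
      linComb (insertAt e p (s e)) b l ∎

    ∙-b′ : ∀ u j → u ∙ b′ j ≡ u ∙ b (punchIn p j) ℚ.+ (ℚ.- t j) ℚ.* u ∙ b p
    ∙-b′ u j = begin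
      sum (λ l → u l ℚ.* (b (punchIn p j) l ℚ.+ (ℚ.- t j) ℚ.* b p l))
        ≡⟨ sum-cong-≗ (λ l → trans (ℚₚ.*-distribˡ-+ (u l) _ _)
             (cong (u l ℚ.* b (punchIn p j) l ℚ.+_) (swap* (u l) (ℚ.- t j) (b p l)))) ⟩
      sum (λ l → u l ℚ.* b (punchIn p j) l ℚ.+ (ℚ.- t j) ℚ.* (u l ℚ.* b p l))
        ≡⟨ ∑-distrib-+ (λ l → u l ℚ.* b (punchIn p j) l) (λ l → (ℚ.- t j) ℚ.* (u l ℚ.* b p l)) ⟩
      u ∙ b (punchIn p j) ℚ.+ sum (λ l → (ℚ.- t j) ℚ.* (u l ℚ.* b p l))
        ≡⟨ cong (u ∙ b (punchIn p j) ℚ.+_) (*-distribˡ-sum (ℚ.- t j) (λ l → u l ℚ.* b p l)) ⟨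
      u ∙ b (punchIn p j) ℚ.+ (ℚ.- t j) ℚ.* u ∙ b p ∎

    member′ : ∀ j → Kernel M (b′ j)
    member′ j zero = begin
      r ∙ b′ j                                                ≡⟨ ∙-b′ r j ⟩
      cⱼ ℚ.+ (ℚ.- t j) ℚ.* c p                                ≡⟨ cong (cⱼ ℚ.+_) (-‿distribˡ-* (t j) (c p)) ⟨
      cⱼ ℚ.+ ℚ.- (cⱼ ℚ.* ℚ.1/ c p ℚ.* c p)
        ≡⟨ cong (λ z → cⱼ ℚ.+ ℚ.- z) (ℚₚ.*-assoc cⱼ (ℚ.1/ c p) (c p)) ⟩
      cⱼ ℚ.+ ℚ.- (cⱼ ℚ.* (ℚ.1/ c p ℚ.* c p))
        ≡⟨ cong (λ z → cⱼ ℚ.+ ℚ.- (cⱼ ℚ.* z)) (ℚₚ.*-inverseˡ (c p)) ⟩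
      cⱼ ℚ.+ ℚ.- (cⱼ ℚ.* 1ℚ)                                  ≡⟨ cong (λ z → cⱼ ℚ.+ ℚ.- z) (ℚₚ.*-identityʳ cⱼ) ⟩
      cⱼ ℚ.+ ℚ.- cⱼ                                           ≡⟨ ℚₚ.+-inverseʳ cⱼ ⟩
      0ℚ                                                      ∎
      where cⱼ = c (punchIn p j)
    member′ j (suc i) = begin
      M (suc i) ∙ b′ j
        ≡⟨ ∙-b′ (M (suc i)) j ⟩
      M (suc i) ∙ b (punchIn p j) ℚ.+ (ℚ.- t j) ℚ.* M (suc i) ∙ b p
        ≡⟨ cong₂ (λ y z → y ℚ.+ (ℚ.- t j) ℚ.* z) (member (punchIn p j) i) (member p i) ⟩
      0ℚ ℚ.+ (ℚ.- t j) ℚ.* 0ℚ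
        ≡⟨ trans (ℚₚ.+-identityˡ _) (ℚₚ.*-zeroʳ (ℚ.- t j)) ⟩
      0ℚ ∎

    independent′ : ∀ e → (∀ l → linComb e b′ l ≡ 0ℚ) → ∀ j → e j ≡ 0ℚ
    independent′ e e≡0 j = trans (sym (insertAt-punchIn e p (s e) j))
      (independent (insertAt e p (s e)) (λ l → trans (sym (linComb-b′ e l)) (e≡0 l)) (punchIn p j))

    spanning′ : ∀ v → Kernel M v → ∃[ e ] linComb e b′ ≗ v
    spanning′ v v∈K with spanning v (λ i → v∈K (suc i))
    ... | a , a≗v = e , λ l → begin
      linComb e b′ l                                            ≡⟨ linComb-b′ e l ⟩
      linComb (insertAt e p (s e)) b l                          ≡⟨ split (insertAt e p (s e)) l ⟩
      insertAt e p (s e) p ℚ.* b p l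
        ℚ.+ sum (λ j → insertAt e p (s e) (punchIn p j) ℚ.* b (punchIn p j) l)
        ≡⟨ cong₂ ℚ._+_ (cong (ℚ._* b p l) (trans (insertAt-lookup e p (s e)) s≡a))
             (sum-cong-≗ (λ j → cong (ℚ._* b (punchIn p j) l) (insertAt-punchIn e p (s e) j))) ⟩
      a p ℚ.* b p l ℚ.+ sum (λ j → e j ℚ.* b (punchIn p j) l)   ≡⟨ split a l ⟨
      linComb a b l                                             ≡⟨ a≗v l ⟩
      v l                                                       ∎
      where
      e : Vector ℚ d
      e = removeAt a p

      S : ℚ
      S = sum λ j → e j ℚ.* c (punchIn p j)

      relation : a p ℚ.* c p ℚ.+ S ≡ 0ℚ
      relation = begin
        a p ℚ.* c p ℚ.+ S             ≡⟨ sum-remove {i = p} (λ i → a i ℚ.* c i) ⟨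
        sum (λ i → a i ℚ.* c i)       ≡⟨ ∙-linComb r a b ⟨
        r ∙ linComb a b               ≡⟨ ∙-congʳ r a≗v ⟩
        r ∙ v                         ≡⟨ v∈K zero ⟩
        0ℚ                            ∎

      step : ∀ j → e j ℚ.* (ℚ.- t j) ≡ e j ℚ.* c (punchIn p j) ℚ.* (ℚ.- (ℚ.1/ c p))
      step j = trans (cong (e j ℚ.*_) (-‿distribʳ-* (c (punchIn p j)) (ℚ.1/ c p)))
                     (sym (ℚₚ.*-assoc (e j) (c (punchIn p j)) (ℚ.- (ℚ.1/ c p))))

      s≡a : s e ≡ a p
      s≡a = begin
        s e                                 ≡⟨ sum-cong-≗ step ⟩
        sum (λ j → e j ℚ.* c (punchIn p j) ℚ.* (ℚ.- (ℚ.1/ c p)))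
          ≡⟨ *-distribʳ-sum (ℚ.- (ℚ.1/ c p)) (λ j → e j ℚ.* c (punchIn p j)) ⟨
        S ℚ.* (ℚ.- (ℚ.1/ c p))              ≡⟨ -‿distribʳ-* S (ℚ.1/ c p) ⟨
        ℚ.- (S ℚ.* ℚ.1/ c p)                ≡⟨ -‿distribˡ-* S (ℚ.1/ c p) ⟩
        (ℚ.- S) ℚ.* ℚ.1/ c p                ≡⟨ cong (ℚ._* ℚ.1/ c p) (+-inverseˡ-unique (a p ℚ.* c p) S relation) ⟨
        a p ℚ.* c p ℚ.* ℚ.1/ c p            ≡⟨ ℚₚ.*-assoc (a p) (c p) (ℚ.1/ c p) ⟩
        a p ℚ.* (c p ℚ.* ℚ.1/ c p)          ≡⟨ cong (a p ℚ.*_) (ℚₚ.*-inverseʳ (c p)) ⟩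
        a p ℚ.* 1ℚ                          ≡⟨ ℚₚ.*-identityʳ (a p) ⟩
        a p                                 ∎

    isBasis : IsBasis (Kernel M) b′
    isBasis = record { member = member′ ; independent = independent′ ; spanning = spanning′ }

  restrict : ∀ {m n d} (M : Matrix ℚ (suc m) n) →
             HasDimension (Kernel (tail M)) d → ∃[ d′ ] HasDimension (Kernel M) d′
  restrict {d = d} M (b , B) with all? (λ i → head M ∙ b i ℚₚ.≟ 0ℚ)
  ... | yes c≡0 = d , b , record
    { member      = λ { i zero → c≡0 i ; i (suc j) → IsBasis.member B i j }
    ; independent = IsBasis.independent B
    ; spanning    = λ v v∈K → IsBasis.spanning B v (λ i → v∈K (suc i))
    }
  restrict {d = zero}  M (b , B) | no ¬c≡0 with () ← ¬c≡0 (λ ())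
  restrict {d = suc d} M (b , B) | no ¬c≡0
    with p , c≢0 ← ¬∀⟶∃¬ (suc d) _ (λ i → head M ∙ b i ℚₚ.≟ 0ℚ) ¬c≡0
    = d , Pivot.b′ M b B p c≢0 , Pivot.isBasis M b B p c≢0

kernel-dimension : ∀ {m n} (M : Matrix ℚ m n) → ∃[ d ] HasDimension (Kernel M) d
kernel-dimension {zero} {n} M = n , δ , record
  { member      = λ _ ()
  ; independent = λ c c≡0 i → trans (sym (linComb-δ c i)) (c≡0 i)
  ; spanning    = λ v _ → v , linComb-δ v
  }
kernel-dimension {suc m} M with d , H ← kernel-dimension (tail M) = restrict M H

nullity : ∀ {m n} → Matrix ℚ m n → ℕ
nullity M = proj₁ (kernel-dimension M)

-- A(n,k,0) has integer entries, so its nullity over ℚ equals that over ℝ.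
N : (n k : ℕ) → ℕ
N n k = nullity (A ℚ.+-*-rawRing n k 0ℚ)

{-# OPTIONS --safe #-}

-- Put n = 2ν and m = n − 1 − k, so that m ≤ ν, and write A(n,k,x) = A₀ + x B.
-- In terms of the prefix sums P of a vector v, row i of A₀ v is
-- P(i+k+1) − P(i+1) − P(i) + P(i−k).  Hence v is in the kernel of A₀ only if
-- P(j) + P(j+1) + P(j+2) = P(n) for j + 2 ≤ m, P(m−1) = 0 and P(m) = P(1), so P is
-- 3-periodic up to m, and P(1) and P(n) determine v.  If m ≡ 1 mod 3, these two
-- values are arbitrary and the nullity is 2; otherwise they must vanish, A₀ is
-- invertible, and D(n,k,0) ≠ 0.
--
-- If m ≡ 1 mod 3, let u, v be the basis of the kernel with u₀ = 1, uₙ₋₁ = 0, v₀ = 0,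
-- vₙ₋₁ = 1.  Replacing the first and the last row of A₀ + x B by its combinations with
-- coefficients u and v, which are x·uB and x·vB, gives D ≡ x² det C mod x³, where C is
-- A₀ with these rows replaced by uB and vB.  By skew-symmetry, det C ≠ 0 as soon as
-- uBv ≠ 0; and in uBv = Σ uᵢ (Bv)ᵢ no term is positive and the first one is −1.

module Submission where

open import Defs
open import Algebra.Bundles using (CommutativeRing; RawRing)
import Algebra.Definitions.RawMagma as RawMagmaDefs
import Algebra.Definitions.RawSemiring as RawSemiringDefs
open import Algebra.Morphism.Structures using (IsRingHomomorphism)
import Algebra.Properties.Semiring.Sum as SemiringSum
open import Data.Bool.Base using (true; false; not; if_then_else_)
open import Data.Empty using (⊥-elim)
open import Data.Fin.Base using (Fin; zero; suc; toℕ; punchIn; fromℕ; fromℕ<)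
open import Data.Fin.Properties using (all?; ¬∀⟶∃¬; punchInᵢ≢i; suc-injective; toℕ<n; toℕ-fromℕ; toℕ-fromℕ<) renaming (_≟_ to _≟ᶠ_)
open import Data.Integer.Base as ℤ using (ℤ; 0ℤ; 1ℤ)
import Data.Integer.Properties as ℤₚ
open import Data.List.Base using ([]; _∷_; map; drop)
open import Data.Nat.Base as ℕ using (ℕ; zero; suc; _∸_; _<ᵇ_; _≤ᵇ_; _≤_; _<_; _≥_; z≤n; s≤s; s<s⁻¹)
import Data.Nat.Properties as ℕₚ
open import Data.Product.Base using (∃-syntax; _×_; _,_; proj₁; proj₂)
open import Data.Rational.Literals using (fromℤ)
open import Data.Sum.Base using (_⊎_; inj₁; inj₂)
open import Data.Vec.Functional using (Vector; tail; removeAt; updateAt; insertAt) renaming (_∷_ to _∷ᵛ_)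
open import Data.Vec.Functional.Properties using (updateAt-updates; updateAt-minimal; insertAt-lookup; insertAt-punchIn)
open import Function.Base using (_∘_; const)
open import Level using (0ℓ)
open import Relation.Binary.PropositionalEquality as ≡ using (_≡_; _≢_; _≗_)
open import Relation.Nullary using (¬_; Dec; yes; no)
open import Relation.Nullary.Decidable using (from-yes)

-- Determinants over a commutative ring

-- The bound k ≥ ν - 1 makes P(i+k+1) or P(i-k) a boundary value, P(n) or P(0) = 0, in every row.
-- With c = k + 1 - m the rows fall into blocks of lengths m, c, m. In the middle block both terms
-- are boundary values and row i reads P(i) + P(i+1) = P(n), a reflection. As n is even, so is c;
-- the reflections cancel in pairs and P(m+c) = P(m), which row 0 turns into P(m) = P(1). The
-- three-term relation combines the rows j, j + 1 and m + c + j. The residue of m modulo 3 decides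
-- whether the periodic sequence 0, p, σ - p meets P(m-1) = 0 and P(m) = P(1) for all p and σ or
-- only for p = σ = 0.
--
-- Because the nullity is 0 or 2, only the coefficients of D up to x² matter; hence the passage to
-- ℚ[x]/(x³).
--
-- The quantity uBv is computable because the rows of A₀ and of B contain the same sum P(i+k+1) +
-- P(i-k): on the kernel of A₀ it equals P(i) + P(i+1), so that (Bv)ᵢ = P(i) + P(i+1) - P(n).

infixl 9 _[_]≔_

_[_]≔_ : ∀ {a} {A : Set a} {n} → Vector A n → Fin n → A → Vector A n
M [ i ]≔ v = updateAt M i (const v)

module Determinant {c ℓ} (R : CommutativeRing c ℓ) where
  open CommutativeRing R hiding (zero)
  open import Algebra.Definitions.RawSemiring (RawRing.rawSemiring rawRing) using (_^_)
  open import Algebra.Properties.Semiring.Sum semiring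
  open import Algebra.Properties.Ring ring using (-‿distribˡ-*)
  open import Relation.Binary.Reasoning.Setoid setoid
  open import Algebra.Solver.Ring.NaturalCoefficients.Default commutativeSemiring
    using (solve; _:+_; _:*_; _:=_)

  ∣_∣ : ∀ {n} → Matrix Carrier n n → Carrier
  ∣ M ∣ = det rawRing M

  ε : ∀ {n} → Fin n → Carrier
  ε i = (- 1#) ^ toℕ i

  infix 4 _≃_
  _≃_ : ∀ {n} → Vector Carrier n → Vector Carrier n → Set ℓ
  u ≃ v = ∀ j → u j ≈ v j

  sum-zero : ∀ {n} {f : Vector Carrier n} → (∀ i → f i ≈ 0#) → sum f ≈ 0#
  sum-zero {n} f≈0 = trans (sum-cong-≋ f≈0) (sum-replicate-zero n)

  sum-single : ∀ {n} (f : Vector Carrier n) p → (∀ i → i ≢ p → f i ≈ 0#) → sum f ≈ f p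
  sum-single {suc n} f p f≈0 = begin
    sum f                       ≈⟨ sum-remove f ⟩
    f p + sum (removeAt f p)    ≈⟨ +-congˡ (sum-zero λ i → f≈0 _ (punchInᵢ≢i p i)) ⟩
    f p + 0#                    ≈⟨ +-identityʳ (f p) ⟩
    f p                         ∎

  det-cong : ∀ {n} {M N : Matrix Carrier n n} → (∀ i → M i ≃ N i) → ∣ M ∣ ≈ ∣ N ∣
  det-cong {zero}  M≃N = refl
  det-cong {suc n} M≃N = sum-cong-≋ λ j →
    *-cong (*-congˡ {ε j} (M≃N zero j)) (det-cong λ i l → M≃N (suc i) (punchIn j l))

  -- The corner term is the same in both expansions. In the others, expanding each minor along its
  -- own first column by induction gives a double sum over a row and a column, which only has to be
  -- summed in the other order.
  det-firstColumn : ∀ {n} (M : Matrix Carrier (suc n) (suc n)) →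
    ∣ M ∣ ≈ sum λ i → ε i * M i zero * ∣ (λ l j → M (punchIn i l) (suc j)) ∣
  det-firstColumn {zero}  M = refl
  det-firstColumn {suc n} M = +-congˡ (begin
    sum (λ j → ε (suc j) * M zero (suc j) * ∣ (λ i l → M (suc i) (punchIn (suc j) l)) ∣)
      ≈⟨ sum-cong-≋ (λ j → trans
           (*-congˡ (det-firstColumn (λ i l → M (suc i) (punchIn (suc j) l))))
           (*-distribˡ-sum (ε (suc j) * M zero (suc j)) (λ i → ε i * M (suc i) zero * E i j))) ⟩
    sum (λ j → sum λ i → ε (suc j) * M zero (suc j) * (ε i * M (suc i) zero * E i j))
      ≈⟨ sum-cong-≋ (λ j → sum-cong-≋ (λ i →
           exchange (- 1#) (ε j) (M zero (suc j)) (ε i) (M (suc i) zero) (E i j))) ⟩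
    sum (λ j → sum λ i → ε (suc i) * M (suc i) zero * (ε j * M zero (suc j) * E i j))
      ≈⟨ ∑-comm (λ j i → ε (suc i) * M (suc i) zero * (ε j * M zero (suc j) * E i j)) ⟩
    sum (λ i → sum λ j → ε (suc i) * M (suc i) zero * (ε j * M zero (suc j) * E i j))
      ≈⟨ sum-cong-≋ (λ i → *-distribˡ-sum (ε (suc i) * M (suc i) zero)
           (λ j → ε j * M zero (suc j) * E i j)) ⟨
    sum (λ i → ε (suc i) * M (suc i) zero * ∣ (λ l j → M (punchIn (suc i) l) (suc j)) ∣) ∎)
    where
    E : Fin (suc n) → Fin (suc n) → Carrier
    E i j = ∣ (λ i′ l → M (suc (punchIn i i′)) (suc (punchIn j l))) ∣

    exchange : ∀ s e a f b E → s * e * a * (f * b * E) ≈ s * f * b * (e * a * E)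
    exchange = solve 6 (λ s e a f b E →
      (s :* e :* a :* (f :* b :* E)) := (s :* f :* b :* (e :* a :* E))) refl

  -- Formulated for three matrices that agree off row `i`, and not with `_[_]≔_`, so that the
  -- induction can pass to minors.
  det-linear : ∀ {n} i a b (L M N : Matrix Carrier n n) →
    (∀ j → L i j ≈ a * M i j + b * N i j) →
    (∀ l → l ≢ i → L l ≃ M l) → (∀ l → l ≢ i → L l ≃ N l) →
    ∣ L ∣ ≈ a * ∣ M ∣ + b * ∣ N ∣
  det-linear {suc n} i a b L M N Lᵢ L≃M L≃N = begin
    sum (λ j → ε j * L zero j * minor L j)
      ≈⟨ sum-cong-≋ (term i Lᵢ L≃M L≃N) ⟩
    sum (λ j → a * (ε j * M zero j * minor M j) + b * (ε j * N zero j * minor N j))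
      ≈⟨ ∑-distrib-+ (λ j → a * (ε j * M zero j * minor M j)) (λ j → b * (ε j * N zero j * minor N j)) ⟩
    sum (λ j → a * (ε j * M zero j * minor M j)) + sum (λ j → b * (ε j * N zero j * minor N j))
      ≈⟨ +-cong (*-distribˡ-sum a (λ j → ε j * M zero j * minor M j))
                (*-distribˡ-sum b (λ j → ε j * N zero j * minor N j)) ⟨
    a * ∣ M ∣ + b * ∣ N ∣ ∎
    where
    minor : Matrix Carrier (suc n) (suc n) → Fin (suc n) → Carrier
    minor K j = ∣ (λ i l → K (suc i) (punchIn j l)) ∣

    row : ∀ e a b x y m → e * (a * x + b * y) * m ≈ a * (e * x * m) + b * (e * y * m)
    row = solve 6 (λ e a b x y m →
      (e :* (a :* x :+ b :* y) :* m) := (a :* (e :* x :* m) :+ b :* (e :* y :* m))) refl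

    below : ∀ e a b x y z → e * x * (a * y + b * z) ≈ a * (e * x * y) + b * (e * x * z)
    below = solve 6 (λ e a b x y z →
      (e :* x :* (a :* y :+ b :* z)) := (a :* (e :* x :* y) :+ b :* (e :* x :* z))) refl

    term : ∀ i → (∀ j → L i j ≈ a * M i j + b * N i j) →
           (∀ l → l ≢ i → L l ≃ M l) → (∀ l → l ≢ i → L l ≃ N l) → ∀ j →
           ε j * L zero j * minor L j ≈ a * (ε j * M zero j * minor M j) + b * (ε j * N zero j * minor N j)
    term zero Lᵢ L≃M L≃N j = begin
      ε j * L zero j * minor L j
        ≈⟨ *-congʳ (*-congˡ (Lᵢ j)) ⟩
      ε j * (a * M zero j + b * N zero j) * minor L j
        ≈⟨ row (ε j) a b (M zero j) (N zero j) (minor L j) ⟩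
      a * (ε j * M zero j * minor L j) + b * (ε j * N zero j * minor L j)
        ≈⟨ +-cong (*-congˡ (*-congˡ (det-cong λ l k → L≃M (suc l) (λ ()) (punchIn j k))))
                  (*-congˡ (*-congˡ (det-cong λ l k → L≃N (suc l) (λ ()) (punchIn j k)))) ⟩
      a * (ε j * M zero j * minor M j) + b * (ε j * N zero j * minor N j) ∎
    term (suc i) Lᵢ L≃M L≃N j = begin
      ε j * L zero j * minor L j
        ≈⟨ *-congˡ (det-linear i a b _ _ _ (Lᵢ ∘ punchIn j)
             (λ l l≢i → L≃M (suc l) (l≢i ∘ suc-injective) ∘ punchIn j)
             (λ l l≢i → L≃N (suc l) (l≢i ∘ suc-injective) ∘ punchIn j)) ⟩
      ε j * L zero j * (a * minor M j + b * minor N j)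
        ≈⟨ below (ε j) a b (L zero j) (minor M j) (minor N j) ⟩
      a * (ε j * L zero j * minor M j) + b * (ε j * L zero j * minor N j)
        ≈⟨ +-cong (*-congˡ (*-congʳ (*-congˡ (L≃M zero (λ ()) j))))
                  (*-congˡ (*-congʳ (*-congˡ (L≃N zero (λ ()) j)))) ⟩
      a * (ε j * M zero j * minor M j) + b * (ε j * N zero j * minor N j) ∎

  module _ {n} (M : Matrix Carrier n n) (i : Fin n) where

    ≔-updates : ∀ v → (M [ i ]≔ v) i ≃ v
    ≔-updates v j = reflexive (≡.cong-app (updateAt-updates i M) j)

    ≔-minimal : ∀ v l → l ≢ i → (M [ i ]≔ v) l ≃ M l
    ≔-minimal v l l≢i j = reflexive (≡.cong-app (updateAt-minimal l i M l≢i) j)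

    det-linear-≔ : ∀ a b u v w → (∀ j → w j ≈ a * u j + b * v j) →
      ∣ M [ i ]≔ w ∣ ≈ a * ∣ M [ i ]≔ u ∣ + b * ∣ M [ i ]≔ v ∣
    det-linear-≔ a b u v w w≈ = det-linear i a b _ _ _
      (λ j → trans (≔-updates w j)
        (trans (w≈ j) (sym (+-cong (*-congˡ (≔-updates u j)) (*-congˡ (≔-updates v j))))))
      (λ l l≢i j → trans (≔-minimal w l l≢i j) (sym (≔-minimal u l l≢i j)))
      (λ l l≢i j → trans (≔-minimal w l l≢i j) (sym (≔-minimal v l l≢i j)))

    ≔-unchanged : ∀ v → v ≃ M i → ∀ l → (M [ i ]≔ v) l ≃ M l
    ≔-unchanged v v≃Mᵢ l with l ≟ᶠ i
    ... | yes ≡.refl = λ j → trans (≔-updates v j) (v≃Mᵢ j)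
    ... | no l≢i     = ≔-minimal v l l≢i

  det-scale : ∀ {n} (M : Matrix Carrier n n) i a u w → (∀ j → w j ≈ a * u j) →
    ∣ M [ i ]≔ w ∣ ≈ a * ∣ M [ i ]≔ u ∣
  det-scale M i a u w w≈ = trans
    (det-linear-≔ M i a 0# u u w (λ j → trans (w≈ j) (sym (+0 _ _))))
    (+0 _ _)
    where
    +0 : ∀ x y → x + 0# * y ≈ x
    +0 x y = trans (+-congˡ (zeroˡ y)) (+-identityʳ x)

  det-add : ∀ {n} (M : Matrix Carrier n n) i v →
    ∣ M [ i ]≔ (λ j → M i j + v j) ∣ ≈ ∣ M ∣ + ∣ M [ i ]≔ v ∣
  det-add M i v = trans
    (det-linear-≔ M i 1# 1# (M i) v _ (λ j → sym (+-cong (*-identityˡ _) (*-identityˡ _))))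
    (+-cong (trans (*-identityˡ _) (det-cong (≔-unchanged M i (M i) (λ _ → refl)))) (*-identityˡ _))

  private
    -- In the expansion along the first column the first two terms have equal minors and opposite
    -- signs; every later minor still has the two equal rows on top.
    det-alternating-01 : ∀ {n} (M : Matrix Carrier (suc (suc n)) (suc (suc n))) →
                         M zero ≃ M (suc zero) → ∣ M ∣ ≈ 0#

    minor-alternating : ∀ {n} (M : Matrix Carrier (suc (suc n)) (suc (suc n))) →
                        M zero ≃ M (suc zero) → ∀ i →
                        ∣ (λ l j → M (punchIn (suc (suc i)) l) (suc j)) ∣ ≈ 0#

  det-alternating-01 {n} M M₀≃M₁ = begin
    ∣ M ∣
      ≈⟨ det-firstColumn M ⟩
    1# * M zero zero * ∣ (λ l j → M (suc l) (suc j)) ∣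
      + (- 1# * 1# * M (suc zero) zero * ∣ (λ l j → M (punchIn (suc zero) l) (suc j)) ∣ + rest)
      ≈⟨ +-congˡ (+-cong
           (*-cong (*-congˡ (sym (M₀≃M₁ zero))) (det-cong minors))
           (sum-zero λ i → trans (*-congˡ (minor-alternating M M₀≃M₁ i)) (zeroʳ _))) ⟩
    1# * M zero zero * m + (- 1# * 1# * M zero zero * m + 0#)
      ≈⟨ +-congˡ (+-identityʳ _) ⟩
    1# * M zero zero * m + - 1# * 1# * M zero zero * m
      ≈⟨ +-congˡ (*-congʳ (*-congʳ (*-identityʳ (- 1#)))) ⟩
    1# * M zero zero * m + - 1# * M zero zero * m
      ≈⟨ +-congˡ (trans (*-congʳ (sym (-‿distribˡ-* 1# _))) (sym (-‿distribˡ-* _ m))) ⟩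
    1# * M zero zero * m - 1# * M zero zero * m
      ≈⟨ -‿inverseʳ _ ⟩
    0# ∎
    where
    m = ∣ (λ l j → M (suc l) (suc j)) ∣

    rest : Carrier
    rest = sum λ i → ε (suc (suc i)) * M (suc (suc i)) zero
                       * ∣ (λ l j → M (punchIn (suc (suc i)) l) (suc j)) ∣

    minors : ∀ l j → M (punchIn (suc zero) l) (suc j) ≈ M (suc l) (suc j)
    minors zero    j = M₀≃M₁ (suc j)
    minors (suc l) j = refl

  minor-alternating {suc n} M M₀≃M₁ i =
    det-alternating-01 (λ l j → M (punchIn (suc (suc i)) l) (suc j)) (M₀≃M₁ ∘ suc)

  det-alternating : ∀ {n} (M : Matrix Carrier n n) p q → p ≢ q → M p ≃ M q → ∣ M ∣ ≈ 0#
  private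
    det-alternating-< : ∀ {n} (M : Matrix Carrier (suc n) (suc n)) q →
                        M zero ≃ M (suc q) → ∣ M ∣ ≈ 0#

    -- Both rows survive in every minor of the expansion along the first row, so the claim descends
    -- to a smaller matrix.
    det-alternating-suc : ∀ {n} (M : Matrix Carrier (suc n) (suc n)) p q → p ≢ q →
                          M (suc p) ≃ M (suc q) → ∣ M ∣ ≈ 0#

  det-alternating M zero    zero    p≢q Mp≃Mq = ⊥-elim (p≢q ≡.refl)
  det-alternating M zero    (suc q) p≢q Mp≃Mq = det-alternating-< M q Mp≃Mq
  det-alternating M (suc p) zero    p≢q Mp≃Mq = det-alternating-< M p (sym ∘ Mp≃Mq)
  det-alternating M (suc p) (suc q) p≢q Mp≃Mq =
    det-alternating-suc M p q (p≢q ∘ ≡.cong suc) Mp≃Mq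

  det-alternating-suc M p q p≢q Mp≃Mq = sum-zero λ j →
    trans (*-congˡ {ε j * M zero j} (det-alternating _ p q p≢q (Mp≃Mq ∘ punchIn j))) (zeroʳ _)

  det-alternating-< {suc n} M zero    M₀≃M₁ = det-alternating-01 M M₀≃M₁
  -- Adding row 1 to row q + 2, and then row 0 = row q + 2 to row 1, preserves the
  -- determinant by the cases already known, and makes rows 1 and q + 2 equal.
  det-alternating-< {suc n} M (suc q) M₀≃M₂ = begin
    ∣ M ∣                  ≈⟨ +-identityʳ _ ⟨
    ∣ M ∣ + 0#             ≈⟨ +-congˡ (det-alternating-suc (M [ q₂ ]≔ M q₁) zero (suc q) (λ ()) λ j →
                                trans (≔-minimal M q₂ (M q₁) q₁ (λ ()) j) (sym (≔-updates M q₂ (M q₁) j))) ⟨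
    ∣ M ∣ + ∣ M [ q₂ ]≔ M q₁ ∣   ≈⟨ det-add M q₂ (M q₁) ⟨
    ∣ M′ ∣                 ≈⟨ +-identityʳ _ ⟨
    ∣ M′ ∣ + 0#            ≈⟨ +-congˡ (det-alternating-01 (M′ [ q₁ ]≔ M zero) λ j → refl) ⟨
    ∣ M′ ∣ + ∣ M′ [ q₁ ]≔ M zero ∣   ≈⟨ det-add M′ q₁ (M zero) ⟨
    ∣ M′ [ q₁ ]≔ v ∣
      ≈⟨ det-alternating-suc (M′ [ q₁ ]≔ v) zero (suc q) (λ ()) (λ j → begin
           M q₁ j + M zero j   ≈⟨ +-comm _ _ ⟩
           M zero j + M q₁ j   ≈⟨ +-congʳ (M₀≃M₂ j) ⟩
           M q₂ j + M q₁ j     ≈⟨ ≔-updates M q₂ _ j ⟨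
           M′ q₂ j             ∎) ⟩
    0#                     ∎
    where
    q₁ q₂ : Fin (suc (suc n))
    q₁ = suc zero
    q₂ = suc (suc q)

    M′ = M [ q₂ ]≔ (λ j → M q₂ j + M q₁ j)
    v = λ j → M′ q₁ j + M zero j

  private
    det-≔-sum : ∀ {m n} (M : Matrix Carrier n n) i (u : Vector Carrier m) (W : Matrix Carrier m n) →
      ∣ M [ i ]≔ (λ j → sum λ l → u l * W l j) ∣ ≈ sum λ l → u l * ∣ M [ i ]≔ W l ∣
    det-≔-sum {zero} M i u W = trans
      (det-scale M i 0# (λ _ → 0#) (λ _ → 0#) (λ _ → sym (zeroˡ 0#))) (zeroˡ _)
    det-≔-sum {suc m} M i u W = trans
      (det-linear-≔ M i (u zero) 1# (W zero) _ _ (λ j → +-congˡ (sym (*-identityˡ _))))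
      (+-congˡ (trans (*-identityˡ _) (det-≔-sum M i (tail u) (tail W))))

  -- By linearity in row `i` the determinant splits over the rows `M l`, and for `l` other than `i`
  -- the row `M l` then occurs twice. When `u i` is 1, a row may thus be replaced by a combination
  -- of rows at no cost.
  det-≔-combination : ∀ {n} (M : Matrix Carrier n n) i (u : Vector Carrier n) →
    ∣ M [ i ]≔ (λ j → sum λ l → u l * M l j) ∣ ≈ u i * ∣ M ∣
  det-≔-combination M i u = begin
    ∣ M [ i ]≔ (λ j → sum λ l → u l * M l j) ∣   ≈⟨ det-≔-sum M i u M ⟩
    sum (λ l → u l * ∣ M [ i ]≔ M l ∣)            ≈⟨ sum-single _ i vanish ⟩
    u i * ∣ M [ i ]≔ M i ∣                        ≈⟨ *-congˡ (det-cong (≔-unchanged M i (M i) (λ _ → refl))) ⟩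
    u i * ∣ M ∣                                   ∎
    where
    vanish : ∀ l → l ≢ i → u l * ∣ M [ i ]≔ M l ∣ ≈ 0#
    vanish l l≢i = trans (*-congˡ (det-alternating _ l i l≢i λ j →
      trans (≔-minimal M i (M l) l l≢i j) (sym (≔-updates M i (M l) j)))) (zeroʳ _)

  private
    -- `L` is turned into `M` one row at a time, so every intermediate matrix has each row from `L`
    -- or from `M`. A general `f` is needed for the induction: it goes on with `f` composed with
    -- prepending the row `L zero`.
    rowwise : ∀ {m n} (f : Matrix Carrier m n → Carrier) →
      (∀ {M N} → (∀ i → M i ≃ N i) → f M ≈ f N) → ∀ L M →
      (∀ i H → (∀ l → H l ≃ L l ⊎ H l ≃ M l) → f (H [ i ]≔ L i) ≈ f (H [ i ]≔ M i)) →
      f L ≈ f M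
    rowwise {zero}  f f-cong L M step = f-cong λ ()
    rowwise {suc m} f f-cong L M step = begin
      f L                                    ≈⟨ f-cong (λ { zero _ → refl ; (suc _) _ → refl }) ⟩
      f (L zero ∷ᵛ tail L)
        ≈⟨ rowwise (λ H → f (L zero ∷ᵛ H))
             (λ M≃N → f-cong λ { zero _ → refl ; (suc i) → M≃N i })
             (tail L) (tail M)
             (λ i H H∈ → begin
               f (L zero ∷ᵛ (H [ i ]≔ L (suc i)))   ≈⟨ f-cong (λ { zero _ → refl ; (suc _) _ → refl }) ⟩
               f ((L zero ∷ᵛ H) [ suc i ]≔ L (suc i))
                 ≈⟨ step (suc i) (L zero ∷ᵛ H) (λ { zero → inj₁ (λ _ → refl) ; (suc l) → H∈ l }) ⟩
               f ((L zero ∷ᵛ H) [ suc i ]≔ M (suc i)) ≈⟨ f-cong (λ { zero _ → refl ; (suc _) _ → refl }) ⟩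
               f (L zero ∷ᵛ (H [ i ]≔ M (suc i)))   ∎) ⟩
      f (L zero ∷ᵛ tail M)                    ≈⟨ f-cong (λ { zero _ → refl ; (suc _) _ → refl }) ⟩
      f ((L zero ∷ᵛ tail M) [ zero ]≔ L zero)
        ≈⟨ step zero (L zero ∷ᵛ tail M) (λ { zero → inj₁ (λ _ → refl) ; (suc l) → inj₂ (λ _ → refl) }) ⟩
      f ((L zero ∷ᵛ tail M) [ zero ]≔ M zero) ≈⟨ f-cong (λ { zero _ → refl ; (suc _) _ → refl }) ⟩
      f M                                    ∎

  -- Row `p` is common to `L` and `M`, hence present in every intermediate matrix; the multiple of
  -- it added to another row contributes a determinant with two equal rows.
  det-addMultiples : ∀ {n} (L M : Matrix Carrier n n) p (c : Vector Carrier n) → L p ≃ M p →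
    (∀ i → i ≢ p → ∀ j → L i j ≈ M i j + c i * M p j) → ∣ L ∣ ≈ ∣ M ∣
  det-addMultiples L M p c Lₚ≃Mₚ L≈ = rowwise ∣_∣ det-cong L M step
    where
    step : ∀ i H → (∀ l → H l ≃ L l ⊎ H l ≃ M l) → ∣ H [ i ]≔ L i ∣ ≈ ∣ H [ i ]≔ M i ∣
    step i H H∈ with i ≟ᶠ p
    ... | yes ≡.refl = trans (det-scale H i 1# (M i) (L i) (λ j → trans (Lₚ≃Mₚ j) (sym (*-identityˡ _))))
                             (*-identityˡ _)
    ... | no i≢p = begin
      ∣ H [ i ]≔ L i ∣
        ≈⟨ det-linear-≔ H i 1# (c i) (M i) (M p) (L i)
             (λ j → trans (L≈ i i≢p j) (+-congʳ (sym (*-identityˡ _)))) ⟩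
      1# * ∣ H [ i ]≔ M i ∣ + c i * ∣ H [ i ]≔ M p ∣
        ≈⟨ +-cong (*-identityˡ _) (*-congˡ (det-alternating _ p i (i≢p ∘ ≡.sym) λ j →
             trans (≔-minimal H i (M p) p (i≢p ∘ ≡.sym) j)
                   (trans (Hₚ≃Mₚ (H∈ p) j) (sym (≔-updates H i (M p) j))))) ⟩
      ∣ H [ i ]≔ M i ∣ + c i * 0#   ≈⟨ +-congˡ (zeroʳ (c i)) ⟩
      ∣ H [ i ]≔ M i ∣ + 0#         ≈⟨ +-identityʳ _ ⟩
      ∣ H [ i ]≔ M i ∣              ∎
      where
      Hₚ≃Mₚ : H p ≃ L p ⊎ H p ≃ M p → H p ≃ M p
      Hₚ≃Mₚ (inj₁ Hₚ≃Lₚ) j = trans (Hₚ≃Lₚ j) (Lₚ≃Mₚ j)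
      Hₚ≃Mₚ (inj₂ Hₚ≃Mₚ) j = Hₚ≃Mₚ j

-- Ring homomorphisms commute with `det` and `A`

module Homomorphism {a ℓ₁ b ℓ₂} (R : RawRing a ℓ₁) (S : CommutativeRing b ℓ₂)
  {φ : RawRing.Carrier R → CommutativeRing.Carrier S}
  (φ-homo : IsRingHomomorphism R (CommutativeRing.rawRing S) φ) where
  private
    module R = RawRing R
    module S = CommutativeRing S
    module Rₛ = RawSemiringDefs R.rawSemiring
    module Sₛ = RawSemiringDefs (RawRing.rawSemiring S.rawRing)
  open IsRingHomomorphism φ-homo
  open import Algebra.Properties.Semiring.Sum S.semiring using (sum-cong-≋)

  sum-homo : ∀ {n} (f : Vector R.Carrier n) → φ (Rₛ.sum f) S.≈ Sₛ.sum (φ ∘ f)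
  sum-homo {zero}  f = 0#-homo
  sum-homo {suc n} f = S.trans (+-homo _ _) (S.+-congˡ (sum-homo (tail f)))

  ε-homo : ∀ k → φ ((R.- R.1#) Rₛ.^ k) S.≈ (S.- S.1#) Sₛ.^ k
  ε-homo zero    = 1#-homo
  ε-homo (suc k) = S.trans (*-homo _ _)
    (S.*-cong (S.trans (-‿homo R.1#) (S.-‿cong 1#-homo)) (ε-homo k))

  det-homo : ∀ {n} (M : Matrix R.Carrier n n) → φ (det R M) S.≈ det S.rawRing (λ i j → φ (M i j))
  det-homo {zero}  M = 1#-homo
  det-homo {suc n} M = S.trans
    (sum-homo λ j → (R.- R.1#) Rₛ.^ toℕ j R.* M zero j R.* det R (minor j))
    (sum-cong-≋ λ j → S.trans (*-homo _ _)
      (S.*-cong (S.trans (*-homo _ (M zero j)) (S.*-congʳ (ε-homo (toℕ j)))) (det-homo (minor j))))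
    where
    minor : Fin (suc n) → Matrix R.Carrier n n
    minor j i l = M (suc i) (punchIn j l)

  A-homo : ∀ n k x i j → φ (A R n k x i j) S.≈ A S.rawRing n k (φ x) i j
  A-homo n k x i j with toℕ i <ᵇ toℕ j | toℕ j ∸ toℕ i ≤ᵇ k | toℕ j <ᵇ toℕ i | toℕ i ∸ toℕ j ≤ᵇ k
  ... | true  | true  | _     | _     = 1#-homo
  ... | true  | false | _     | _     = -‿homo x
  ... | false | _     | true  | true  = S.trans (-‿homo _) (S.-‿cong 1#-homo)
  ... | false | _     | true  | false = S.trans (-‿homo _) (S.-‿cong (-‿homo x))
  ... | false | _     | false | _     = 0#-homo

-- Linear algebra over ℚ

open import Data.Rational.Base as ℚ using (ℚ; 0ℚ; 1ℚ; _+_; _*_; -_; _-_)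
import Data.Rational.Properties as ℚₚ
open import Data.Rational.Solver using (module +-*-Solver)
import Data.Rational.Unnormalised.Base as ℚᵘ
import Data.Rational.Unnormalised.Properties as ℚᵘₚ
open ≡ using (refl; sym; trans; cong; cong₂; subst; subst₂; isEquivalence; module ≡-Reasoning)
open SemiringSum (CommutativeRing.semiring ℚₚ.+-*-commutativeRing)
  using (sum; sum-cong-≗; sum-remove; ∑-distrib-+; ∑-comm; *-distribˡ-sum; *-distribʳ-sum)
open Determinant ℚₚ.+-*-commutativeRing
open +-*-Solver using (solve; _:+_; _:*_; _:-_; :-_; _:=_; con)

*-cancel-≢0 : ∀ {x} y → x ≢ 0ℚ → x * y ≡ 0ℚ → y ≡ 0ℚ
*-cancel-≢0 {x} y x≢0 xy≡0 = begin
  y                  ≡⟨ ℚₚ.*-identityˡ y ⟨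
  1ℚ * y             ≡⟨ cong (_* y) (ℚₚ.*-inverseˡ x) ⟨
  ℚ.1/ x * x * y     ≡⟨ ℚₚ.*-assoc (ℚ.1/ x) x y ⟩
  ℚ.1/ x * (x * y)   ≡⟨ cong (ℚ.1/ x *_) xy≡0 ⟩
  ℚ.1/ x * 0ℚ        ≡⟨ ℚₚ.*-zeroʳ (ℚ.1/ x) ⟩
  0ℚ                 ∎
  where
  open ≡-Reasoning
  instance _ = ℚ.≢-nonZero x≢0

*-≢0 : ∀ {x y} → x ≢ 0ℚ → y ≢ 0ℚ → x * y ≢ 0ℚ
*-≢0 {x} {y} x≢0 y≢0 = y≢0 ∘ *-cancel-≢0 y x≢0

ε≢0 : ∀ {n} (i : Fin n) → ε i ≢ 0ℚ
ε≢0 zero    = λ ()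
ε≢0 (suc i) = *-≢0 { - 1ℚ} (λ ()) (ε≢0 i)

Dependent : ∀ {m n} → Matrix ℚ m n → Set
Dependent M = ∃[ w ] (∃[ i ] w i ≢ 0ℚ) × (∀ j → linComb w M j ≡ 0ℚ)

module Elimination {m n} (M : Matrix ℚ (suc m) (suc n)) (p : Fin (suc m)) (Mₚ≢0 : M p zero ≢ 0ℚ) where
  open ≡-Reasoning
  private instance _ = ℚ.≢-nonZero Mₚ≢0

  factor : Vector ℚ (suc m)
  factor i = - (M i zero * ℚ.1/ M p zero)

  reducedRow : Fin (suc m) → Vector ℚ (suc n)
  reducedRow i j = M i j + factor i * M p j

  reducedRow-zero : ∀ i → reducedRow i zero ≡ 0ℚ
  reducedRow-zero i = begin
    x + - (x * y⁻¹) * y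
      ≡⟨ solve 3 (λ x y y⁻¹ → x :+ :- (x :* y⁻¹) :* y := x :+ :- (x :* (y⁻¹ :* y))) refl x y y⁻¹ ⟩
    x + - (x * (y⁻¹ * y))   ≡⟨ cong (λ z → x + - (x * z)) (ℚₚ.*-inverseˡ y) ⟩
    x + - (x * 1ℚ)          ≡⟨ cong (λ z → x + - z) (ℚₚ.*-identityʳ x) ⟩
    x + - x                 ≡⟨ ℚₚ.+-inverseʳ x ⟩
    0ℚ                      ∎
    where
    x = M i zero
    y = M p zero
    y⁻¹ = ℚ.1/ M p zero

  reduced : Matrix ℚ m n
  reduced i j = reducedRow (punchIn p i) (suc j)

  -- A relation `w` among the reduced rows is a relation among the rows of `M` in which the pivot
  -- row collects all the multiples that were added, in total `s`. The column dropped by `reduced`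
  -- causes no trouble, since `reducedRow` is zero there.
  dependent : Dependent reduced → Dependent M
  dependent (w , (i , wᵢ≢0) , w≡0) =
    v , (punchIn p i , wᵢ≢0 ∘ trans (sym (insertAt-punchIn w p s i))) , λ j → begin
      linComb v M j
        ≡⟨ sum-remove {i = p} (λ l → v l * M l j) ⟩
      v p * M p j + sum (λ l → v (punchIn p l) * M (punchIn p l) j)
        ≡⟨ cong₂ _+_ (cong (_* M p j) (insertAt-lookup w p s))
             (sum-cong-≗ (λ l → cong (_* M (punchIn p l) j) (insertAt-punchIn w p s l))) ⟩
      s * M p j + sum (λ l → w l * M (punchIn p l) j)
        ≡⟨ cong (_+ sum (λ l → w l * M (punchIn p l) j))
             (*-distribʳ-sum (M p j) (λ l → w l * factor (punchIn p l))) ⟩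
      sum (λ l → w l * factor (punchIn p l) * M p j) + sum (λ l → w l * M (punchIn p l) j)
        ≡⟨ ∑-distrib-+ (λ l → w l * factor (punchIn p l) * M p j) (λ l → w l * M (punchIn p l) j) ⟨
      sum (λ l → w l * factor (punchIn p l) * M p j + w l * M (punchIn p l) j)
        ≡⟨ sum-cong-≗ (λ l → solve 4 (λ w f x y → w :* f :* x :+ w :* y := w :* (y :+ f :* x)) refl
             (w l) (factor (punchIn p l)) (M p j) (M (punchIn p l) j)) ⟩
      sum (λ l → w l * reducedRow (punchIn p l) j)
        ≡⟨ vanish j ⟩
      0ℚ ∎
    where
    s = sum λ l → w l * factor (punchIn p l)
    v = insertAt w p s

    vanish : ∀ j → sum (λ l → w l * reducedRow (punchIn p l) j) ≡ 0ℚ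
    vanish zero    = sum-zero λ l → trans (cong (w l *_) (reducedRow-zero (punchIn p l))) (ℚₚ.*-zeroʳ (w l))
    vanish (suc j) = w≡0 j

det-elimination : ∀ {n} (M : Matrix ℚ (suc n) (suc n)) p (Mₚ≢0 : M p zero ≢ 0ℚ) →
                  ∣ M ∣ ≡ ε p * M p zero * ∣ Elimination.reduced M p Mₚ≢0 ∣
det-elimination M p Mₚ≢0 = begin
  ∣ M ∣                                       ≡⟨ det-addMultiples L M p factor Lₚ (λ i i≢p → L≡ i≢p) ⟨
  ∣ L ∣                                       ≡⟨ det-firstColumn L ⟩
  sum (λ i → ε i * L i zero * ∣ minor i ∣)    ≡⟨ sum-single _ p vanish ⟩
  ε p * L p zero * ∣ minor p ∣                ≡⟨ cong₂ (λ x y → ε p * x * y) (Lₚ zero)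
                                                   (det-cong λ l j → L≡ (punchInᵢ≢i p l) (suc j)) ⟩
  ε p * M p zero * ∣ reduced ∣                ∎
  where
  open ≡-Reasoning
  open Elimination M p Mₚ≢0

  -- `factor p` is -1, so `reducedRow p` is the zero row; the pivot row has to be put back.
  L = reducedRow [ p ]≔ M p

  minor = λ i l j → L (punchIn i l) (suc j)

  Lₚ : L p ≗ M p
  Lₚ = ≔-updates reducedRow p (M p)

  L≡ : ∀ {i} → i ≢ p → L i ≗ reducedRow i
  L≡ {i} = ≔-minimal reducedRow p (M p) i

  vanish : ∀ i → i ≢ p → ε i * L i zero * ∣ minor i ∣ ≡ 0ℚ
  vanish i i≢p = begin
    ε i * L i zero * ∣ minor i ∣   ≡⟨ cong (λ x → ε i * x * ∣ minor i ∣) (trans (L≡ i≢p zero) (reducedRow-zero i)) ⟩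
    ε i * 0ℚ * ∣ minor i ∣         ≡⟨ cong (_* ∣ minor i ∣) (ℚₚ.*-zeroʳ (ε i)) ⟩
    0ℚ * ∣ minor i ∣               ≡⟨ ℚₚ.*-zeroˡ ∣ minor i ∣ ⟩
    0ℚ                             ∎

pivot? : ∀ {m n} (M : Matrix ℚ m (suc n)) → (∀ i → M i zero ≡ 0ℚ) ⊎ (∃[ p ] M p zero ≢ 0ℚ)
pivot? {m} M with all? (λ i → M i zero ℚₚ.≟ 0ℚ)
... | yes M≡0 = inj₁ M≡0
... | no ¬M≡0 = inj₂ (¬∀⟶∃¬ m _ (λ i → M i zero ℚₚ.≟ 0ℚ) ¬M≡0)

dependent-zeroColumn : ∀ {m n} (M : Matrix ℚ m (suc n)) → (∀ i → M i zero ≡ 0ℚ) →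
                       Dependent (λ i → tail (M i)) → Dependent M
dependent-zeroColumn M M≡0 (w , w≢0 , w≡0) = w , w≢0 , λ where
  zero    → sum-zero λ i → trans (cong (w i *_) (M≡0 i)) (ℚₚ.*-zeroʳ (w i))
  (suc j) → w≡0 j

moreRows⇒dependent : ∀ {m n} (M : Matrix ℚ m n) → n < m → Dependent M
moreRows⇒dependent {suc m} {zero}  M n<m = (λ _ → 1ℚ) , (zero , λ ()) , λ ()
moreRows⇒dependent {suc m} {suc n} M n<m with pivot? M
... | inj₁ M≡0        = dependent-zeroColumn M M≡0 (moreRows⇒dependent (λ i → tail (M i)) (ℕₚ.<-trans (ℕₚ.n<1+n n) n<m))
... | inj₂ (p , Mₚ≢0) = Elimination.dependent M p Mₚ≢0
                          (moreRows⇒dependent _ (s<s⁻¹ n<m))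

-- Gaussian elimination on the first column. If that column is zero, the remaining columns are fewer
-- than the rows, which forces a relation; otherwise both alternatives lift from the reduced matrix.
det≢0⊎dependent : ∀ {n} (M : Matrix ℚ n n) → ∣ M ∣ ≢ 0ℚ ⊎ Dependent M
det≢0⊎dependent {zero}  M = inj₁ λ ()
det≢0⊎dependent {suc n} M with pivot? M
... | inj₁ M≡0        = inj₂ (dependent-zeroColumn M M≡0 (moreRows⇒dependent (λ i → tail (M i)) (ℕₚ.n<1+n n)))
... | inj₂ (p , Mₚ≢0) with det≢0⊎dependent (Elimination.reduced M p Mₚ≢0)
...   | inj₁ det≢0 = inj₁ (*-≢0 (*-≢0 (ε≢0 p) Mₚ≢0) det≢0 ∘ trans (sym (det-elimination M p Mₚ≢0)))
...   | inj₂ dep   = inj₂ (Elimination.dependent M p Mₚ≢0 dep)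

independentRows⇒det≢0 : ∀ {n} (M : Matrix ℚ n n) →
  (∀ w → (∀ j → linComb w M j ≡ 0ℚ) → ∀ i → w i ≡ 0ℚ) → ∣ M ∣ ≢ 0ℚ
independentRows⇒det≢0 M independent with det≢0⊎dependent M
... | inj₁ det≢0                 = det≢0
... | inj₂ (w , (i , wᵢ≢0) , w≡0) = ⊥-elim (wᵢ≢0 (independent w w≡0 i))

linComb-linComb : ∀ {l m n} (w : Vector ℚ l) (C : Matrix ℚ l m) (b : Matrix ℚ m n) →
                  linComb w (λ i → linComb (C i) b) ≗ linComb (linComb w C) b
linComb-linComb w C b j = begin
  sum (λ i → w i * sum (λ r → C i r * b r j))
    ≡⟨ sum-cong-≗ (λ i → *-distribˡ-sum (w i) (λ r → C i r * b r j)) ⟩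
  sum (λ i → sum (λ r → w i * (C i r * b r j)))
    ≡⟨ ∑-comm (λ i r → w i * (C i r * b r j)) ⟩
  sum (λ r → sum (λ i → w i * (C i r * b r j)))
    ≡⟨ sum-cong-≗ (λ r → trans (sum-cong-≗ (λ i → sym (ℚₚ.*-assoc (w i) (C i r) (b r j))))
         (sym (*-distribʳ-sum (b r j) (λ i → w i * C i r)))) ⟩
  sum (λ r → sum (λ i → w i * C i r) * b r j) ∎
  where open ≡-Reasoning

-- If d exceeded e, the d coordinate vectors with respect to `b′` would be dependent, and their
-- relation would be one among the vectors `b`.
basis-size-≤ : ∀ {n d e} {V : Vector ℚ n → Set} {b : Fin d → Vector ℚ n} {b′ : Fin e → Vector ℚ n} →
               IsBasis V b → IsBasis V b′ → d ≤ e
basis-size-≤ {b = b} {b′} B B′ = ℕₚ.≮⇒≥ (absurd ∘ moreRows⇒dependent C)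
  where
  open ≡-Reasoning
  coordinates : ∀ i → ∃[ c ] linComb c b′ ≗ b i
  coordinates i = IsBasis.spanning B′ (b i) (IsBasis.member B i)

  C = λ i → proj₁ (coordinates i)

  absurd : ¬ Dependent C
  absurd (w , (i , wᵢ≢0) , w≡0) = wᵢ≢0 (IsBasis.independent B w relation i)
    where
    relation : ∀ j → linComb w b j ≡ 0ℚ
    relation j = begin
      linComb w b j                         ≡⟨ sum-cong-≗ (λ i → cong (w i *_) (proj₂ (coordinates i) j)) ⟨
      linComb w (λ i → linComb (C i) b′) j  ≡⟨ linComb-linComb w C b′ j ⟩
      linComb (linComb w C) b′ j            ≡⟨ sum-zero (λ r → trans (cong (_* b′ r j) (w≡0 r)) (ℚₚ.*-zeroˡ (b′ r j))) ⟩
      0ℚ                                    ∎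

-- `nullity` is the output of an algorithm; this lets any explicit basis of the kernel determine it.
nullity-unique : ∀ {m n d} (M : Matrix ℚ m n) → HasDimension (Kernel M) d → nullity M ≡ d
nullity-unique M (b , B) with kernel-dimension M
... | _ , b′ , B′ = ℕₚ.≤-antisym (basis-size-≤ B′ B) (basis-size-≤ B B′)

-- Polynomials modulo x³

record Jet : Set where
  constructor jet
  field
    c₀ c₁ c₂ : ℚ

open Jet

ι : ℚ → Jet
ι a = jet a 0ℚ 0ℚ

x : Jet
x = jet 0ℚ 1ℚ 0ℚ

jet-cong : ∀ {a b c a′ b′ c′} → a ≡ a′ → b ≡ b′ → c ≡ c′ → jet a b c ≡ jet a′ b′ c′
jet-cong refl refl refl = refl

jetRawRing : RawRing 0ℓ 0ℓ
jetRawRing = record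
  { Carrier = Jet
  ; _≈_     = _≡_
  ; _+_     = λ { (jet a b c) (jet a′ b′ c′) → jet (a + a′) (b + b′) (c + c′) }
  ; _*_     = λ { (jet a b c) (jet a′ b′ c′) →
                jet (a * a′) (a * b′ + b * a′) (a * c′ + b * b′ + c * a′) }
  ; -_      = λ { (jet a b c) → jet (- a) (- b) (- c) }
  ; 0#      = ι 0ℚ
  ; 1#      = ι 1ℚ
  }

jetRing : CommutativeRing 0ℓ 0ℓ
jetRing = record
  { RawRing jetRawRing
  ; isCommutativeRing = record
    { isRing = record
      { +-isAbelianGroup = record
        { isGroup = record
          { isMonoid = record
            { isSemigroup = record
              { isMagma = record { isEquivalence = isEquivalence ; ∙-cong = cong₂ J._+_ }
              ; assoc   = λ p q r → jet-cong
                  (ℚₚ.+-assoc (c₀ p) (c₀ q) (c₀ r)) (ℚₚ.+-assoc (c₁ p) (c₁ q) (c₁ r)) (ℚₚ.+-assoc (c₂ p) (c₂ q) (c₂ r))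
              }
            ; identity = (λ p → jet-cong (ℚₚ.+-identityˡ (c₀ p)) (ℚₚ.+-identityˡ (c₁ p)) (ℚₚ.+-identityˡ (c₂ p)))
                       , (λ p → jet-cong (ℚₚ.+-identityʳ (c₀ p)) (ℚₚ.+-identityʳ (c₁ p)) (ℚₚ.+-identityʳ (c₂ p)))
            }
          ; inverse = (λ p → jet-cong (ℚₚ.+-inverseˡ (c₀ p)) (ℚₚ.+-inverseˡ (c₁ p)) (ℚₚ.+-inverseˡ (c₂ p)))
                    , (λ p → jet-cong (ℚₚ.+-inverseʳ (c₀ p)) (ℚₚ.+-inverseʳ (c₁ p)) (ℚₚ.+-inverseʳ (c₂ p)))
          ; ⁻¹-cong = cong J.-_
          }
        ; comm = λ p q → jet-cong (ℚₚ.+-comm (c₀ p) (c₀ q)) (ℚₚ.+-comm (c₁ p) (c₁ q)) (ℚₚ.+-comm (c₂ p) (c₂ q))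
        }
      ; *-cong     = cong₂ J._*_
      ; *-assoc    = *-assoc
      ; *-identity = *-identityˡ , λ p → trans (*-comm p J.1#) (*-identityˡ p)
      ; distrib    = distribˡ , λ p q r → trans (*-comm (q J.+ r) p)
                       (trans (distribˡ p q r) (cong₂ J._+_ (*-comm p q) (*-comm p r)))
      }
    ; *-comm = *-comm
    }
  }
  where
  module J = RawRing jetRawRing

  *-comm : ∀ p q → p J.* q ≡ q J.* p
  *-comm (jet a b c) (jet a′ b′ c′) = jet-cong
    (ℚₚ.*-comm a a′)
    (solve 4 (λ a b a′ b′ → a :* b′ :+ b :* a′ := a′ :* b :+ b′ :* a) refl a b a′ b′)
    (solve 6 (λ a b c a′ b′ c′ →
       a :* c′ :+ b :* b′ :+ c :* a′ := a′ :* c :+ b′ :* b :+ c′ :* a) refl a b c a′ b′ c′)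

  *-identityˡ : ∀ p → J.1# J.* p ≡ p
  *-identityˡ (jet a b c) = jet-cong
    (ℚₚ.*-identityˡ a)
    (solve 2 (λ a b → con 1ℚ :* b :+ con 0ℚ :* a := b) refl a b)
    (solve 3 (λ a b c → con 1ℚ :* c :+ con 0ℚ :* b :+ con 0ℚ :* a := c) refl a b c)

  *-assoc : ∀ p q r → p J.* q J.* r ≡ p J.* (q J.* r)
  *-assoc (jet a b c) (jet a′ b′ c′) (jet a″ b″ c″) = jet-cong
    (ℚₚ.*-assoc a a′ a″)
    (solve 6 (λ a b a′ b′ a″ b″ →
       a :* a′ :* b″ :+ (a :* b′ :+ b :* a′) :* a″ :=
       a :* (a′ :* b″ :+ b′ :* a″) :+ b :* (a′ :* a″)) refl a b a′ b′ a″ b″)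
    (solve 9 (λ a b c a′ b′ c′ a″ b″ c″ →
       a :* a′ :* c″ :+ (a :* b′ :+ b :* a′) :* b″ :+ (a :* c′ :+ b :* b′ :+ c :* a′) :* a″ :=
       a :* (a′ :* c″ :+ b′ :* b″ :+ c′ :* a″) :+ b :* (a′ :* b″ :+ b′ :* a″) :+ c :* (a′ :* a″))
       refl a b c a′ b′ c′ a″ b″ c″)

  distribˡ : ∀ p q r → p J.* (q J.+ r) ≡ p J.* q J.+ p J.* r
  distribˡ (jet a b c) (jet a′ b′ c′) (jet a″ b″ c″) = jet-cong
    (ℚₚ.*-distribˡ-+ a a′ a″)
    (solve 6 (λ a b a′ b′ a″ b″ →
       a :* (b′ :+ b″) :+ b :* (a′ :+ a″) :=
       a :* b′ :+ b :* a′ :+ (a :* b″ :+ b :* a″)) refl a b a′ b′ a″ b″)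
    (solve 9 (λ a b c a′ b′ c′ a″ b″ c″ →
       a :* (c′ :+ c″) :+ b :* (b′ :+ b″) :+ c :* (a′ :+ a″) :=
       a :* c′ :+ b :* b′ :+ c :* a′ :+ (a :* c″ :+ b :* b″ :+ c :* a″))
       refl a b c a′ b′ c′ a″ b″ c″)

c₀-homo : IsRingHomomorphism jetRawRing ℚ.+-*-rawRing c₀
c₀-homo = record
  { isSemiringHomomorphism = record
    { isNearSemiringHomomorphism = record
      { +-isMonoidHomomorphism = record
        { isMagmaHomomorphism = record
          { isRelHomomorphism = record { cong = cong c₀ }
          ; homo = λ _ _ → refl
          }
        ; ε-homo = refl
        }
      ; *-homo = λ _ _ → refl
      }
    ; 1#-homo = refl
    }
  ; -‿homo = λ _ → refl
  }

fromℤ-+ : ∀ i j → fromℤ (i ℤ.+ j) ≡ fromℤ i + fromℤ j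
fromℤ-+ i j = ℚₚ.toℚᵘ-injective (ℚᵘₚ.≃-trans
  (ℚᵘ.*≡* (cong (ℤ._* ℤ.1ℤ) (sym (cong₂ ℤ._+_ (ℤₚ.*-identityʳ i) (ℤₚ.*-identityʳ j)))))
  (ℚᵘₚ.≃-sym (ℚₚ.toℚᵘ-homo-+ (fromℤ i) (fromℤ j))))

fromℤ-* : ∀ i j → fromℤ (i ℤ.* j) ≡ fromℤ i * fromℤ j
fromℤ-* i j = ℚₚ.toℚᵘ-injective (ℚᵘₚ.≃-sym (ℚₚ.toℚᵘ-homo-* (fromℤ i) (fromℤ j)))

fromℤ-‿- : ∀ i → fromℤ (ℤ.- i) ≡ - fromℤ i
fromℤ-‿- i = ℚₚ.toℚᵘ-injective (ℚᵘₚ.≃-sym (ℚₚ.toℚᵘ-homo‿- (fromℤ i)))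

fromℤ-injective : ∀ {i j} → fromℤ i ≡ fromℤ j → i ≡ j
fromℤ-injective = cong ℚ.↥_

coeff-+ : ∀ p q i → coeff (p +ₚ q) i ≡ coeff p i ℤ.+ coeff q i
coeff-+ []      q       i       = sym (ℤₚ.+-identityˡ (coeff q i))
coeff-+ (a ∷ p) []      i       = sym (ℤₚ.+-identityʳ (coeff (a ∷ p) i))
coeff-+ (a ∷ p) (b ∷ q) zero    = refl
coeff-+ (a ∷ p) (b ∷ q) (suc i) = coeff-+ p q i

coeff-map : ∀ (f : ℤ → ℤ) → f ℤ.0ℤ ≡ ℤ.0ℤ → ∀ p i → coeff (map f p) i ≡ f (coeff p i)
coeff-map f f0≡0 []      i       = sym f0≡0
coeff-map f f0≡0 (a ∷ p) zero    = refl
coeff-map f f0≡0 (a ∷ p) (suc i) = coeff-map f f0≡0 p i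

coeff-*-zero : ∀ p q → coeff (p *ₚ q) 0 ≡ coeff p 0 ℤ.* coeff q 0
coeff-*-zero []      q = refl
coeff-*-zero (a ∷ p) q = begin
  coeff (map (a ℤ.*_) q +ₚ (ℤ.0ℤ ∷ p *ₚ q)) 0   ≡⟨ coeff-+ (map (a ℤ.*_) q) (ℤ.0ℤ ∷ p *ₚ q) 0 ⟩
  coeff (map (a ℤ.*_) q) 0 ℤ.+ ℤ.0ℤ             ≡⟨ ℤₚ.+-identityʳ _ ⟩
  coeff (map (a ℤ.*_) q) 0                      ≡⟨ coeff-map (a ℤ.*_) (ℤₚ.*-zeroʳ a) q 0 ⟩
  a ℤ.* coeff q 0                               ∎
  where open ≡-Reasoning

coeff-∷-*-suc : ∀ a p q i → coeff ((a ∷ p) *ₚ q) (suc i) ≡ a ℤ.* coeff q (suc i) ℤ.+ coeff (p *ₚ q) i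
coeff-∷-*-suc a p q i = trans (coeff-+ (map (a ℤ.*_) q) (ℤ.0ℤ ∷ p *ₚ q) (suc i))
  (cong (ℤ._+ coeff (p *ₚ q) i) (coeff-map (a ℤ.*_) (ℤₚ.*-zeroʳ a) q (suc i)))

coeff-*-one : ∀ p q → coeff (p *ₚ q) 1 ≡ coeff p 0 ℤ.* coeff q 1 ℤ.+ coeff p 1 ℤ.* coeff q 0
coeff-*-one []      q = refl
coeff-*-one (a ∷ p) q = trans (coeff-∷-*-suc a p q 0) (cong (λ c → a ℤ.* coeff q 1 ℤ.+ c) (coeff-*-zero p q))

coeff-*-two : ∀ p q → coeff (p *ₚ q) 2 ≡
  coeff p 0 ℤ.* coeff q 2 ℤ.+ coeff p 1 ℤ.* coeff q 1 ℤ.+ coeff p 2 ℤ.* coeff q 0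
coeff-*-two []      q = refl
coeff-*-two (a ∷ p) q = trans (coeff-∷-*-suc a p q 1)
  (trans (cong (λ c → a ℤ.* coeff q 2 ℤ.+ c) (coeff-*-one p q)) (sym (ℤₚ.+-assoc (a ℤ.* coeff q 2) _ _)))

truncate : Poly → Jet
truncate p = jet (fromℤ (coeff p 0)) (fromℤ (coeff p 1)) (fromℤ (coeff p 2))

truncate-homo : IsRingHomomorphism ℤ[X] jetRawRing truncate
truncate-homo = record
  { isSemiringHomomorphism = record
    { isNearSemiringHomomorphism = record
      { +-isMonoidHomomorphism = record
        { isMagmaHomomorphism = record
          { isRelHomomorphism = record
            { cong = λ p≈q → jet-cong (cong fromℤ (p≈q 0)) (cong fromℤ (p≈q 1)) (cong fromℤ (p≈q 2)) }
          ; homo = λ p q → jet-cong (+-homo p q 0) (+-homo p q 1) (+-homo p q 2)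
          }
        ; ε-homo = refl
        }
      ; *-homo = λ p q → jet-cong
          (trans (cong fromℤ (coeff-*-zero p q)) (fromℤ-* (coeff p 0) (coeff q 0)))
          (trans (cong fromℤ (coeff-*-one p q)) (*+* p 0 q 1 p 1 q 0))
          (trans (cong fromℤ (coeff-*-two p q))
            (trans (fromℤ-+ (coeff p 0 ℤ.* coeff q 2 ℤ.+ coeff p 1 ℤ.* coeff q 1) (coeff p 2 ℤ.* coeff q 0))
              (cong₂ _+_ (*+* p 0 q 2 p 1 q 1) (fromℤ-* (coeff p 2) (coeff q 0)))))
      }
    ; 1#-homo = refl
    }
  ; -‿homo = λ p → jet-cong (-‿homo p 0) (-‿homo p 1) (-‿homo p 2)
  }
  where
  *+* : ∀ p i q j p′ i′ q′ j′ →
    fromℤ (coeff p i ℤ.* coeff q j ℤ.+ coeff p′ i′ ℤ.* coeff q′ j′) ≡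
    fromℤ (coeff p i) * fromℤ (coeff q j) + fromℤ (coeff p′ i′) * fromℤ (coeff q′ j′)
  *+* p i q j p′ i′ q′ j′ = trans
    (fromℤ-+ (coeff p i ℤ.* coeff q j) (coeff p′ i′ ℤ.* coeff q′ j′))
    (cong₂ _+_ (fromℤ-* (coeff p i) (coeff q j)) (fromℤ-* (coeff p′ i′) (coeff q′ j′)))

  +-homo : ∀ p q i → fromℤ (coeff (p +ₚ q) i) ≡ fromℤ (coeff p i) + fromℤ (coeff q i)
  +-homo p q i = trans (cong fromℤ (coeff-+ p q i)) (fromℤ-+ (coeff p i) (coeff q i))

  -‿homo : ∀ p i → fromℤ (coeff (map ℤ.-_ p) i) ≡ - fromℤ (coeff p i)
  -‿homo p i = trans (cong fromℤ (coeff-map ℤ.-_ refl p i)) (fromℤ-‿- (coeff p i))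

private
  module J = CommutativeRing jetRing
  module Jₛ = SemiringSum J.semiring
  module Jₚ = Determinant jetRing

pencil : ∀ {m n} → Matrix ℚ m n → Matrix ℚ m n → Matrix Jet m n
pencil A₀ B i j = jet (A₀ i j) (B i j) 0ℚ

-- A combination that annihilates the constant parts is divisible by x. This is the source of each
-- of the two factors x of the determinant.
pencil-combination : ∀ {n} (u a b : Vector ℚ n) → sum (λ l → u l * a l) ≡ 0ℚ →
  Jₛ.sum (λ l → ι (u l) J.* jet (a l) (b l) 0ℚ) ≡ x J.* ι (sum λ l → u l * b l)
pencil-combination u a b ua≡0 = trans (general u a b) (jet-cong
  (trans ua≡0 (sym (ℚₚ.*-zeroˡ s)))
  (solve 1 (λ s → s := con 0ℚ :* con 0ℚ :+ con 1ℚ :* s) refl s)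
  (solve 1 (λ s → con 0ℚ := con 0ℚ :* con 0ℚ :+ con 1ℚ :* con 0ℚ :+ con 0ℚ :* s) refl s))
  where
  s = sum λ l → u l * b l

  general : ∀ {n} (u a b : Vector ℚ n) →
    Jₛ.sum (λ l → ι (u l) J.* jet (a l) (b l) 0ℚ) ≡ jet (sum λ l → u l * a l) (sum λ l → u l * b l) 0ℚ
  general {zero}  u a b = refl
  general {suc n} u a b = trans
    (cong (ι (u zero) J.* jet (a zero) (b zero) 0ℚ J.+_) (general (tail u) (tail a) (tail b)))
    (jet-cong refl
      (cong (_+ sum (λ l → u (suc l) * b (suc l)))
        (solve 3 (λ u a b → u :* b :+ con 0ℚ :* a := u :* b) refl (u zero) (a zero) (b zero)))
      (solve 3 (λ u a b → u :* con 0ℚ :+ con 0ℚ :* b :+ con 0ℚ :* a :+ con 0ℚ := con 0ℚ)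
        refl (u zero) (a zero) (b zero)))

-- Perturbation of a determinant along two kernel vectors

module Perturbation {n} (A₀ B : Matrix ℚ n n) {p q : Fin n} (p≢q : p ≢ q) (u v : Vector ℚ n)
  (uₚ≡1 : u p ≡ 1ℚ) (v_q≡1 : v q ≡ 1ℚ) (vₚ≡0 : v p ≡ 0ℚ)
  (uA₀≡0 : ∀ j → linComb u A₀ j ≡ 0ℚ) (vA₀≡0 : ∀ j → linComb v A₀ j ≡ 0ℚ) where

  C : Matrix ℚ n n
  C = A₀ [ p ]≔ linComb u B [ q ]≔ linComb v B

  private
    W W₁ W₂ : Matrix Jet n n
    W  = pencil A₀ B
    W₁ = W [ p ]≔ (λ j → ι (linComb u B j))
    W₂ = W₁ [ q ]≔ (λ j → ι (linComb v B j))

    -- Row `p` has already been replaced in `W₁`, but `v p` is 0, so the combination does not see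
    -- the change. This is why the basis is normalised to have `vₚ≡0`.
    W₁-combination : ∀ j → Jₛ.sum (λ l → ι (v l) J.* W₁ l j) ≡ x J.* ι (linComb v B j)
    W₁-combination j = trans (Jₛ.sum-cong-≗ term)
      (pencil-combination v (λ l → A₀ l j) (λ l → B l j) (vA₀≡0 j))
      where
      term : ∀ l → ι (v l) J.* W₁ l j ≡ ι (v l) J.* W l j
      term l with l ≟ᶠ p
      ... | yes refl = trans (cong (λ z → ι z J.* W₁ l j) vₚ≡0)
                         (trans (J.zeroˡ (W₁ l j)) (sym (trans (cong (λ z → ι z J.* W l j) vₚ≡0) (J.zeroˡ (W l j)))))
      ... | no l≢p   = cong (ι (v l) J.*_) (Jₚ.≔-minimal W p _ l l≢p j)

    c₀-W₂ : ∀ l j → c₀ (W₂ l j) ≡ C l j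
    c₀-W₂ l j with l ≟ᶠ q
    ... | yes refl = trans (cong c₀ (Jₚ.≔-updates W₁ l _ j)) (sym (≔-updates (A₀ [ p ]≔ linComb u B) l _ j))
    ... | no l≢q   = trans (cong c₀ (Jₚ.≔-minimal W₁ q _ l l≢q j))
                       (trans (c₀-W₁ (l ≟ᶠ p)) (sym (≔-minimal (A₀ [ p ]≔ linComb u B) q _ l l≢q j)))
      where
      c₀-W₁ : Dec (l ≡ p) → c₀ (W₁ l j) ≡ (A₀ [ p ]≔ linComb u B) l j
      c₀-W₁ (yes refl) = trans (cong c₀ (Jₚ.≔-updates W l _ j)) (sym (≔-updates A₀ l _ j))
      c₀-W₁ (no l≢p)   = trans (cong c₀ (Jₚ.≔-minimal W p _ l l≢p j)) (sym (≔-minimal A₀ p _ l l≢p j))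

  det-pencil : Jₚ.∣ pencil A₀ B ∣ ≡ jet 0ℚ 0ℚ ∣ C ∣
  det-pencil = begin
    Jₚ.∣ W ∣                     ≡⟨ J.*-identityˡ Jₚ.∣ W ∣ ⟨
    ι 1ℚ J.* Jₚ.∣ W ∣            ≡⟨ cong (λ z → ι z J.* Jₚ.∣ W ∣) uₚ≡1 ⟨
    ι (u p) J.* Jₚ.∣ W ∣         ≡⟨ Jₚ.det-≔-combination W p (ι ∘ u) ⟨
    Jₚ.∣ W [ p ]≔ (λ j → Jₛ.sum λ l → ι (u l) J.* W l j) ∣
      ≡⟨ Jₚ.det-scale W p x _ _ (λ j → pencil-combination u (λ l → A₀ l j) (λ l → B l j) (uA₀≡0 j)) ⟩
    x J.* Jₚ.∣ W₁ ∣              ≡⟨ cong (x J.*_) (J.*-identityˡ Jₚ.∣ W₁ ∣) ⟨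
    x J.* (ι 1ℚ J.* Jₚ.∣ W₁ ∣)   ≡⟨ cong (λ z → x J.* (ι z J.* Jₚ.∣ W₁ ∣)) v_q≡1 ⟨
    x J.* (ι (v q) J.* Jₚ.∣ W₁ ∣) ≡⟨ cong (x J.*_) (Jₚ.det-≔-combination W₁ q (ι ∘ v)) ⟨
    x J.* Jₚ.∣ W₁ [ q ]≔ (λ j → Jₛ.sum λ l → ι (v l) J.* W₁ l j) ∣
      ≡⟨ cong (x J.*_) (Jₚ.det-scale W₁ q x _ _ W₁-combination) ⟩
    -- Modulo x³ only the constant term of the last determinant survives multiplication by x², and
    -- taking constant terms is a ring homomorphism.
    x J.* (x J.* Jₚ.∣ W₂ ∣)      ≡⟨ x*x* Jₚ.∣ W₂ ∣ ⟩
    jet 0ℚ 0ℚ (c₀ Jₚ.∣ W₂ ∣)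
      ≡⟨ cong (jet 0ℚ 0ℚ) (trans (Homomorphism.det-homo jetRawRing ℚₚ.+-*-commutativeRing c₀-homo W₂) (det-cong c₀-W₂)) ⟩
    jet 0ℚ 0ℚ ∣ C ∣              ∎
    where
    open ≡-Reasoning
    x*x* : ∀ w → x J.* (x J.* w) ≡ jet 0ℚ 0ℚ (c₀ w)
    x*x* (jet a b c) = jet-cong
      (solve 1 (λ a → con 0ℚ :* (con 0ℚ :* a) := con 0ℚ) refl a)
      (solve 2 (λ a b → con 0ℚ :* (con 0ℚ :* b :+ con 1ℚ :* a) :+ con 1ℚ :* (con 0ℚ :* a) := con 0ℚ) refl a b)
      (solve 3 (λ a b c → con 0ℚ :* (con 0ℚ :* c :+ con 1ℚ :* b :+ con 0ℚ :* a)
         :+ con 1ℚ :* (con 0ℚ :* b :+ con 1ℚ :* a) :+ con 0ℚ :* (con 0ℚ :* a) := a) refl a b c)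

  module _
    (A₀u≡0 : Kernel A₀ u) (A₀v≡0 : Kernel A₀ v)
    (uBu≡0 : linComb u B ∙ u ≡ 0ℚ) (vBv≡0 : linComb v B ∙ v ≡ 0ℚ)
    (uBv≢0 : linComb u B ∙ v ≢ 0ℚ) (vBu≢0 : linComb v B ∙ u ≢ 0ℚ)
    (determined : ∀ w → (∀ j → linComb w A₀ j ≡ 0ℚ) → w p ≡ 0ℚ → w q ≡ 0ℚ → ∀ i → w i ≡ 0ℚ)
    where

    private
      C-p : C p ≗ linComb u B
      C-p j = trans (≔-minimal (A₀ [ p ]≔ linComb u B) q _ p p≢q j) (≔-updates A₀ p _ j)

      C-q : C q ≗ linComb v B
      C-q = ≔-updates (A₀ [ p ]≔ linComb u B) q _

      C-other : ∀ {l} → l ≢ p → l ≢ q → C l ≗ A₀ l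
      C-other {l} l≢p l≢q j = trans (≔-minimal (A₀ [ p ]≔ linComb u B) q _ l l≢q j) (≔-minimal A₀ p _ l l≢p j)

      ∙-congˡ : ∀ {a b : Vector ℚ n} z → a ≗ b → a ∙ z ≡ b ∙ z
      ∙-congˡ z a≗b = sum-cong-≗ λ j → cong (_* z j) (a≗b j)

    -- Let wC = 0. Pairing with v kills the unchanged rows because A₀v = 0, and row `q` because vBv
    -- = 0; what is left is w(p) · uBv = 0. Pairing with u gives w(q) = 0 in the same way. Then w
    -- cannot tell `C` from `A₀`, and `determined` applies.
    det-C≢0 : ∣ C ∣ ≢ 0ℚ
    det-C≢0 = independentRows⇒det≢0 C λ w wC≡0 →
      let
        -- Pairing the relation with z leaves a single term.
        coefficient : ∀ z r → C r ∙ z ≢ 0ℚ → (∀ l → l ≢ r → C l ∙ z ≡ 0ℚ) → w r ≡ 0ℚ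
        coefficient z r Cᵣz≢0 Cz≡0 = *-cancel-≢0 (w r) Cᵣz≢0 (begin
          C r ∙ z * w r                        ≡⟨ ℚₚ.*-comm (C r ∙ z) (w r) ⟩
          w r * C r ∙ z                        ≡⟨ sum-single _ r (λ l l≢r →
                                                    trans (cong (w l *_) (Cz≡0 l l≢r)) (ℚₚ.*-zeroʳ (w l))) ⟨
          sum (λ l → w l * C l ∙ z)            ≡⟨ linComb-linComb w C (λ j (_ : Fin 1) → z j) zero ⟩
          linComb w C ∙ z                      ≡⟨ sum-zero (λ j → trans (cong (_* z j) (wC≡0 j)) (ℚₚ.*-zeroˡ (z j))) ⟩
          0ℚ                                   ∎)

        wₚ≡0 = coefficient v p (uBv≢0 ∘ trans (sym (∙-congˡ v C-p))) λ l l≢p → Cv≡0 l l≢p (l ≟ᶠ q)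
        w_q≡0 = coefficient u q (vBu≢0 ∘ trans (sym (∙-congˡ u C-q))) λ l l≢q → Cu≡0 l l≢q (l ≟ᶠ p)
      in determined w (λ j → trans (sum-cong-≗ λ l → term w wₚ≡0 w_q≡0 j l (l ≟ᶠ p) (l ≟ᶠ q)) (wC≡0 j)) wₚ≡0 w_q≡0
      where
      open ≡-Reasoning

      Cv≡0 : ∀ l → l ≢ p → Dec (l ≡ q) → C l ∙ v ≡ 0ℚ
      Cv≡0 l l≢p (yes refl) = trans (∙-congˡ v C-q) vBv≡0
      Cv≡0 l l≢p (no l≢q)   = trans (∙-congˡ v (C-other l≢p l≢q)) (A₀v≡0 l)

      Cu≡0 : ∀ l → l ≢ q → Dec (l ≡ p) → C l ∙ u ≡ 0ℚ
      Cu≡0 l l≢q (yes refl) = trans (∙-congˡ u C-p) uBu≡0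
      Cu≡0 l l≢q (no l≢p)   = trans (∙-congˡ u (C-other l≢p l≢q)) (A₀u≡0 l)

      0*≡0* : ∀ {a} b c → a ≡ 0ℚ → a * b ≡ a * c
      0*≡0* b c refl = trans (ℚₚ.*-zeroˡ b) (sym (ℚₚ.*-zeroˡ c))

      term : ∀ w → w p ≡ 0ℚ → w q ≡ 0ℚ → ∀ j l → Dec (l ≡ p) → Dec (l ≡ q) → w l * A₀ l j ≡ w l * C l j
      term w wₚ≡0 w_q≡0 j l (yes refl) _          = 0*≡0* (A₀ l j) (C l j) wₚ≡0
      term w wₚ≡0 w_q≡0 j l (no _)     (yes refl) = 0*≡0* (A₀ l j) (C l j) w_q≡0
      term w wₚ≡0 w_q≡0 j l (no l≢p)   (no l≢q)   = cong (w l *_) (sym (C-other l≢p l≢q j))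

-- The rows of A(n,k,x) in terms of prefix sums

skewToeplitz : (ℕ → ℚ) → ℕ → ℕ → ℚ
skewToeplitz f i j = if i <ᵇ j then f (j ∸ i) else if j <ᵇ i then - f (i ∸ j) else 0ℚ

skewToeplitz-skew : ∀ f i j → skewToeplitz f i j ≡ - skewToeplitz f j i
skewToeplitz-skew f zero    zero    = refl
skewToeplitz-skew f zero    (suc j) = solve 1 (λ x → x := :- (:- x)) refl (f (suc j))
skewToeplitz-skew f (suc i) zero    = refl
skewToeplitz-skew f (suc i) (suc j) = skewToeplitz-skew f i j

step : ℕ → ℚ → ℚ → ℕ → ℚ
step k a b d = if d ≤ᵇ k then a else b

A₀ : (n k : ℕ) → Matrix ℚ n n
A₀ n k i j = skewToeplitz (step k 1ℚ 0ℚ) (toℕ i) (toℕ j)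

B : (n k : ℕ) → Matrix ℚ n n
B n k i j = skewToeplitz (step k 0ℚ (- 1ℚ)) (toℕ i) (toℕ j)

A-jet : ∀ n k i j → A jetRawRing n k x i j ≡ pencil (A₀ n k) (B n k) i j
A-jet n k i j with toℕ i <ᵇ toℕ j | toℕ j ∸ toℕ i ≤ᵇ k | toℕ j <ᵇ toℕ i | toℕ i ∸ toℕ j ≤ᵇ k
... | true  | true  | _     | _     = refl
... | true  | false | _     | _     = refl
... | false | _     | true  | true  = refl
... | false | _     | true  | false = refl
... | false | _     | false | _     = refl

χ : ℕ → ℕ → ℚ
χ i q = if i <ᵇ q then 1ℚ else 0ℚ

<ᵇ-suc : ∀ i k → (k <ᵇ suc i) ≡ not (i <ᵇ k)
<ᵇ-suc i       zero    = refl
<ᵇ-suc zero    (suc k) = refl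
<ᵇ-suc (suc i) (suc k) = <ᵇ-suc i k

χ-+ : ∀ j k i → χ (j ℕ.+ k) i ≡ χ j (i ∸ k)
χ-+ j zero    i       = cong (λ z → χ z i) (ℕₚ.+-identityʳ j)
χ-+ j (suc k) zero    = refl
χ-+ j (suc k) (suc i) = trans (cong (λ z → χ z (suc i)) (ℕₚ.+-suc j k)) (χ-+ j k i)

-- Row i is 1 on the interval from i + 1 to i + k and -1 on the one from i - k to i - 1; each
-- interval is a difference of two initial segments. The last term is `χ (j + k) i` and not
-- `χ j (i ∸ k)`, so that all terms are invariant under increasing i and j together, which makes the
-- diagonal step definitional.
A₀-entry : ∀ k i j → skewToeplitz (step k 1ℚ 0ℚ) i j ≡
  χ j (i ℕ.+ suc k) - χ j (suc i) - χ j i + χ (j ℕ.+ k) i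
A₀-entry k zero    zero    = refl
A₀-entry k zero    (suc j) with j <ᵇ k
... | true  = refl
... | false = refl
A₀-entry k (suc i) zero    rewrite <ᵇ-suc i k with i <ᵇ k
... | true  = refl
... | false = refl
A₀-entry k (suc i) (suc j) = A₀-entry k i j

-- The first two terms give -1 to the right of the band and the last one gives 1 to the left of it.
-- The summand `0ℚ` only keeps the four-term shape that `sum-linear` expects.
B-entry : ∀ k i j → skewToeplitz (step k 0ℚ (- 1ℚ)) i j ≡
  χ j (i ℕ.+ suc k) - 1ℚ - 0ℚ + χ (j ℕ.+ k) i
B-entry k zero    zero    = refl
B-entry k zero    (suc j) with j <ᵇ k
... | true  = refl
... | false = refl
B-entry k (suc i) zero    rewrite <ᵇ-suc i k with i <ᵇ k
... | true  = refl
... | false = refl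
B-entry k (suc i) (suc j) = B-entry k i j

prefix : ∀ {n} → Vector ℚ n → ℕ → ℚ
prefix v q = sum λ j → χ (toℕ j) q * v j

prefix-zero : ∀ {n} (v : Vector ℚ n) → prefix v 0 ≡ 0ℚ
prefix-zero v = sum-zero λ j → ℚₚ.*-zeroˡ (v j)

prefix-suc : ∀ {n} (v : Vector ℚ n) j → prefix v (suc (toℕ j)) ≡ prefix v (toℕ j) + v j
prefix-suc v zero    = solve 2 (λ a b → con 1ℚ :* a :+ b := con 0ℚ :* a :+ b :+ a) refl
  (v zero) (prefix (tail v) 0)
prefix-suc v (suc j) = trans (cong (1ℚ * v zero +_) (prefix-suc (tail v) j))
  (sym (ℚₚ.+-assoc (1ℚ * v zero) (prefix (tail v) (toℕ j)) (v (suc j))))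

prefix-≥ : ∀ {n} (v : Vector ℚ n) q → n ≤ q → prefix v q ≡ sum v
prefix-≥ {zero}  v q       n≤q       = refl
prefix-≥ {suc n} v (suc q) (s≤s n≤q) = cong₂ _+_ (ℚₚ.*-identityˡ (v zero)) (prefix-≥ (tail v) q n≤q)

differences : ∀ n → (ℕ → ℚ) → Vector ℚ n
differences n P j = P (suc (toℕ j)) - P (toℕ j)

prefix-differences : ∀ n P → P 0 ≡ 0ℚ → ∀ q → q ≤ n → prefix (differences n P) q ≡ P q
prefix-differences n P P0≡0 q q≤n = trans (general n P q q≤n)
  (trans (cong (λ y → P q - y) P0≡0) (solve 1 (λ x → x :- con 0ℚ := x) refl (P q)))
  where
  general : ∀ n P q → q ≤ n → prefix (differences n P) q ≡ P q - P 0
  general n       P zero    q≤n       = trans (prefix-zero (differences n P)) (sym (ℚₚ.+-inverseʳ (P 0)))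
  general (suc n) P (suc q) (s≤s q≤n) = trans
    (cong (1ℚ * (P 1 - P 0) +_) (general n (P ∘ suc) q q≤n))
    (solve 3 (λ a b c → con 1ℚ :* (b :- a) :+ (c :- b) := c :- a) refl (P 0) (P 1) (P (suc q)))

sum-linear : ∀ {n} (a b c d v : Vector ℚ n) → sum (λ j → (a j - b j - c j + d j) * v j) ≡
  sum (λ j → a j * v j) - sum (λ j → b j * v j) - sum (λ j → c j * v j) + sum (λ j → d j * v j)
sum-linear {zero}  a b c d v = refl
sum-linear {suc n} a b c d v = trans
  (cong ((a zero - b zero - c zero + d zero) * v zero +_) (sum-linear (tail a) (tail b) (tail c) (tail d) (tail v)))
  (solve 9 (λ a b c d v x y z w →
     (a :- b :- c :+ d) :* v :+ (x :- y :- z :+ w) :=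
     (a :* v :+ x) :- (b :* v :+ y) :- (c :* v :+ z) :+ (d :* v :+ w)) refl
     (a zero) (b zero) (c zero) (d zero) (v zero) _ _ _ _)

A₀-row : ∀ {n} k (v : Vector ℚ n) i → A₀ n k i ∙ v ≡
  prefix v (toℕ i ℕ.+ suc k) - prefix v (suc (toℕ i)) - prefix v (toℕ i) + prefix v (toℕ i ∸ k)
A₀-row k v i = trans
  (sum-cong-≗ λ j → cong (_* v j) (trans (A₀-entry k (toℕ i) (toℕ j))
    (cong (χ (toℕ j) (toℕ i ℕ.+ suc k) - χ (toℕ j) (suc (toℕ i)) - χ (toℕ j) (toℕ i) +_) (χ-+ (toℕ j) k (toℕ i)))))
  (sum-linear (λ j → χ (toℕ j) (toℕ i ℕ.+ suc k)) (λ j → χ (toℕ j) (suc (toℕ i)))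
    (λ j → χ (toℕ j) (toℕ i)) (λ j → χ (toℕ j) (toℕ i ∸ k)) v)

B-row : ∀ {n} k (v : Vector ℚ n) i → B n k i ∙ v ≡
  prefix v (toℕ i ℕ.+ suc k) - sum v + prefix v (toℕ i ∸ k)
B-row k v i = trans
  (sum-cong-≗ λ j → cong (_* v j) (trans (B-entry k (toℕ i) (toℕ j))
    (cong (χ (toℕ j) (toℕ i ℕ.+ suc k) - 1ℚ - 0ℚ +_) (χ-+ (toℕ j) k (toℕ i)))))
  (trans (sum-linear (λ j → χ (toℕ j) (toℕ i ℕ.+ suc k)) (λ _ → 1ℚ) (λ _ → 0ℚ) (λ j → χ (toℕ j) (toℕ i ∸ k)) v)
    (cong (_+ prefix v (toℕ i ∸ k)) (trans
      (cong₂ (λ y z → prefix v (toℕ i ℕ.+ suc k) - y - z)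
        (sum-cong-≗ λ j → ℚₚ.*-identityˡ (v j)) (sum-zero λ j → ℚₚ.*-zeroˡ (v j)))
      (solve 1 (λ x → x :- con 0ℚ := x) refl (prefix v (toℕ i ℕ.+ suc k) - sum v)))))

-- Skew-symmetric matrices and their bilinear forms

module SkewForm {n} (M : Matrix ℚ n n) (skew : ∀ i j → M i j ≡ - M j i) where
  open ≡-Reasoning

  sum-neg : ∀ {n} (f : Vector ℚ n) → sum (λ i → - f i) ≡ - sum f
  sum-neg {zero}  f = refl
  sum-neg {suc n} f = trans (cong (- f zero +_) (sum-neg (tail f))) (sym (ℚₚ.neg-distrib-+ (f zero) (sum (tail f))))

  linComb-skew : ∀ u j → linComb u M j ≡ - (M j ∙ u)
  linComb-skew u j = begin
    sum (λ i → u i * M i j)       ≡⟨ sum-cong-≗ (λ i → trans (cong (u i *_) (skew i j))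
                                       (solve 2 (λ a b → a :* (:- b) := :- (b :* a)) refl (u i) (M j i))) ⟩
    sum (λ i → - (M j i * u i))   ≡⟨ sum-neg (λ i → M j i * u i) ⟩
    - (M j ∙ u)                   ∎

  form : ∀ u v → linComb u M ∙ v ≡ sum (λ i → u i * M i ∙ v)
  form u v = sym (linComb-linComb u M (λ j (_ : Fin 1) → v j) zero)

  form-skew : ∀ u v → linComb u M ∙ v ≡ - (linComb v M ∙ u)
  form-skew u v = begin
    linComb u M ∙ v                       ≡⟨ sum-cong-≗ (λ j → trans (cong (_* v j) (linComb-skew u j))
                                               (solve 2 (λ a b → (:- a) :* b := :- (b :* a)) refl (M j ∙ u) (v j))) ⟩
    sum (λ j → - (v j * M j ∙ u))         ≡⟨ sum-neg (λ j → v j * M j ∙ u) ⟩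
    - sum (λ j → v j * M j ∙ u)           ≡⟨ cong -_ (form v u) ⟨
    - (linComb v M ∙ u)                   ∎

  form-alternating : ∀ u → linComb u M ∙ u ≡ 0ℚ
  form-alternating u = *-cancel-≢0 {1ℚ + 1ℚ} y (λ ()) (begin
    (1ℚ + 1ℚ) * y   ≡⟨ solve 1 (λ y → (con 1ℚ :+ con 1ℚ) :* y := y :+ y) refl y ⟩
    y + y           ≡⟨ cong (y +_) (form-skew u u) ⟩
    y + - y         ≡⟨ ℚₚ.+-inverseʳ y ⟩
    0ℚ              ∎)
    where y = linComb u M ∙ u

  kernel⇒linComb≡0 : ∀ u → Kernel M u → ∀ j → linComb u M j ≡ 0ℚ
  kernel⇒linComb≡0 u Mu≡0 j = trans (linComb-skew u j) (cong -_ (Mu≡0 j))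

  linComb≡0⇒kernel : ∀ u → (∀ j → linComb u M j ≡ 0ℚ) → Kernel M u
  linComb≡0⇒kernel u uM≡0 i = begin
    M i ∙ u            ≡⟨ solve 1 (λ x → x := :- (:- x)) refl (M i ∙ u) ⟩
    - - (M i ∙ u)      ≡⟨ cong -_ (linComb-skew u i) ⟨
    - linComb u M i    ≡⟨ cong -_ (uM≡0 i) ⟩
    - 0ℚ               ∎

-- The indices below m + c + m, split according to which of the two terms
-- P (i + k + 1) and P (i ∸ k) of a row of A(n,k,0) is a boundary value.
data Block (m c : ℕ) : ℕ → Set where
  first  : ∀ {i} → i < m → Block m c i
  middle : ∀ {j} → j < c → Block m c (m ℕ.+ j)
  last   : ∀ {j} → j < m → Block m c (m ℕ.+ c ℕ.+ j)

block : ∀ m c i → i < m ℕ.+ c ℕ.+ m → Block m c i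
block m c i i<n with i ℕₚ.<? m
... | yes i<m = first i<m
... | no i≮m with i ℕₚ.<? m ℕ.+ c
...   | yes i<m+c with j , refl ← ℕₚ.m≤n⇒∃[o]m+o≡n (ℕₚ.≮⇒≥ i≮m) = middle (ℕₚ.+-cancelˡ-< m j c i<m+c)
...   | no i≮m+c with j , refl ← ℕₚ.m≤n⇒∃[o]m+o≡n (ℕₚ.≮⇒≥ i≮m+c) = last (ℕₚ.+-cancelˡ-< (m ℕ.+ c) j m i<n)

-- The kernel equations for prefix sums and their consequences

module _ (m c : ℕ) (P : ℕ → ℚ) (σ : ℚ) where

  -- The sum P(i+k+1) + P(i-k) after inserting the boundary values: 0 at index 0, to which `i ∸ k`
  -- truncates in the first two blocks, and `σ` from index n on, which i + k + 1 reaches in the last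
  -- two. In the last block i = k + 1 + j, so i - k is j + 1.
  target : ∀ {i} → Block m c i → ℚ
  target (first {i} _)  = P (m ℕ.+ c ℕ.+ i)
  target (middle _)     = σ
  target (last {j} _)   = σ + P (suc j)

  Relations : Set
  Relations = ∀ {i} (b : Block m c i) → P i + P (suc i) ≡ target b

  target-≡ : ∀ k → suc k ≡ m ℕ.+ c → P 0 ≡ 0ℚ → (∀ q → m ℕ.+ c ℕ.+ m ≤ q → P q ≡ σ) →
             ∀ {i} (b : Block m c i) → P (i ℕ.+ suc k) + P (i ∸ k) ≡ target b
  target-≡ k k+1≡m+c P0≡0 P≥n (first {i} i<m) = begin
    P (i ℕ.+ suc k) + P (i ∸ k)
      ≡⟨ cong₂ (λ y z → P y + P z)
           (trans (cong (i ℕ.+_) k+1≡m+c) (ℕₚ.+-comm i (m ℕ.+ c)))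
           (ℕₚ.m≤n⇒m∸n≡0 (ℕ.s≤s⁻¹ i≤k)) ⟩
    P (m ℕ.+ c ℕ.+ i) + P 0    ≡⟨ cong (P (m ℕ.+ c ℕ.+ i) +_) P0≡0 ⟩
    P (m ℕ.+ c ℕ.+ i) + 0ℚ     ≡⟨ ℚₚ.+-identityʳ _ ⟩
    P (m ℕ.+ c ℕ.+ i)          ∎
    where
    open ≡-Reasoning
    i≤k : i < suc k
    i≤k = subst (i <_) (sym k+1≡m+c) (ℕₚ.<-≤-trans i<m (ℕₚ.m≤m+n m c))
  target-≡ k k+1≡m+c P0≡0 P≥n (middle {j} j<c) = begin
    P (m ℕ.+ j ℕ.+ suc k) + P (m ℕ.+ j ∸ k)
      ≡⟨ cong₂ _+_ (P≥n _ n≤) (cong P (ℕₚ.m≤n⇒m∸n≡0 (ℕ.s≤s⁻¹ i≤k))) ⟩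
    σ + P 0     ≡⟨ cong (σ +_) P0≡0 ⟩
    σ + 0ℚ      ≡⟨ ℚₚ.+-identityʳ σ ⟩
    σ           ∎
    where
    open ≡-Reasoning
    i≤k : m ℕ.+ j < suc k
    i≤k = subst (m ℕ.+ j <_) (sym k+1≡m+c) (ℕₚ.+-monoʳ-< m j<c)
    n≤ : m ℕ.+ c ℕ.+ m ≤ m ℕ.+ j ℕ.+ suc k
    n≤ = subst₂ _≤_ (ℕₚ.+-comm m (m ℕ.+ c)) (cong (m ℕ.+ j ℕ.+_) (sym k+1≡m+c))
           (ℕₚ.+-monoˡ-≤ (m ℕ.+ c) (ℕₚ.m≤m+n m j))
  target-≡ k k+1≡m+c P0≡0 P≥n (last {j} j<m) =
    cong₂ _+_ (P≥n _ n≤) (cong P (trans (cong (λ z → z ℕ.+ j ∸ k) (sym k+1≡m+c))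
      (trans (cong (_∸ k) (sym (ℕₚ.+-suc k j))) (ℕₚ.m+n∸m≡n k (suc j)))))
    where
    n≤ : m ℕ.+ c ℕ.+ m ≤ m ℕ.+ c ℕ.+ j ℕ.+ suc k
    n≤ = subst₂ _≤_ (ℕₚ.+-comm m (m ℕ.+ c)) (cong (m ℕ.+ c ℕ.+ j ℕ.+_) (sym k+1≡m+c))
           (ℕₚ.+-monoˡ-≤ (m ℕ.+ c) (ℕₚ.≤-trans (ℕₚ.m≤m+n m c) (ℕₚ.m≤m+n (m ℕ.+ c) j)))

module _ (p σ : ℚ) where

  -- The only sequence that starts with 0, p and has sum σ over any three consecutive terms.
  π : ℕ → ℚ
  π 0                   = 0ℚ
  π 1                   = p
  π 2                   = σ - p
  π (suc (suc (suc i))) = π i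

  π-threeTerm : ∀ i → π i + π (suc i) + π (suc (suc i)) ≡ σ
  π-threeTerm 0 = solve 2 (λ p σ → con 0ℚ :+ p :+ (σ :- p) := σ) refl p σ
  π-threeTerm 1 = solve 2 (λ p σ → p :+ (σ :- p) :+ con 0ℚ := σ) refl p σ
  π-threeTerm 2 = solve 2 (λ p σ → (σ :- p) :+ con 0ℚ :+ p := σ) refl p σ
  π-threeTerm (suc (suc (suc i))) = π-threeTerm i

  π-3t : ∀ t → π (t ℕ.* 3) ≡ 0ℚ
  π-3t zero    = refl
  π-3t (suc t) = π-3t t

  π-3t+1 : ∀ t → π (suc (t ℕ.* 3)) ≡ p
  π-3t+1 zero    = refl
  π-3t+1 (suc t) = π-3t+1 t

  π-3t+2 : ∀ t → π (suc (suc (t ℕ.* 3))) ≡ σ - p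
  π-3t+2 zero    = refl
  π-3t+2 (suc t) = π-3t+2 t

private
  threeTerm : ∀ {a b c q r σ} → a + b ≡ q → b + c ≡ r → q + r ≡ σ + b → a + b + c ≡ σ
  threeTerm {a} {b} {c} {σ = σ} refl refl e = begin
    a + b + c                 ≡⟨ solve 3 (λ a b c → a :+ b :+ c := (a :+ b) :+ (b :+ c) :- b) refl a b c ⟩
    (a + b) + (b + c) - b     ≡⟨ cong (_- b) e ⟩
    σ + b - b                 ≡⟨ solve 2 (λ σ b → σ :+ b :- b := σ) refl σ b ⟩
    σ                         ∎
    where open ≡-Reasoning

  solveʳ : ∀ {a b c} → a + b ≡ c → b ≡ c - a
  solveʳ {a} {b} refl = solve 2 (λ a b → b := a :+ b :- a) refl a b

  0+0 : ∀ {a b} → a ≡ 0ℚ → b ≡ 0ℚ → a + b ≡ 0ℚ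
  0+0 refl refl = refl

module Solutions {m s : ℕ} {P : ℕ → ℚ} {σ : ℚ} (relations : Relations m (s ℕ.+ s) P σ)
  (P0≡0 : P 0 ≡ 0ℚ) (Pn≡σ : P (m ℕ.+ (s ℕ.+ s) ℕ.+ m) ≡ σ) where
  open ≡-Reasoning

  c : ℕ
  c = s ℕ.+ s

  middle-step : ∀ {j} → j < c → P (m ℕ.+ suc j) ≡ σ - P (m ℕ.+ j)
  middle-step {j} j<c = trans (cong P (ℕₚ.+-suc m j)) (solveʳ (relations (middle j<c)))

  -- Each row of the middle block replaces P by σ - P, and two such reflections cancel.
  middle-even : ∀ r → r ≤ s → P (m ℕ.+ (r ℕ.+ r)) ≡ P m
  middle-even zero    r≤s = cong P (ℕₚ.+-identityʳ m)
  middle-even (suc r) r<s = begin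
    P (m ℕ.+ suc (r ℕ.+ suc r))         ≡⟨ cong (λ z → P (m ℕ.+ suc z)) (ℕₚ.+-suc r r) ⟩
    P (m ℕ.+ suc (suc (r ℕ.+ r)))       ≡⟨ middle-step 2r+1<c ⟩
    σ - P (m ℕ.+ suc (r ℕ.+ r))         ≡⟨ cong (λ z → σ - z) (middle-step (ℕₚ.<-trans (ℕₚ.n<1+n _) 2r+1<c)) ⟩
    σ - (σ - P (m ℕ.+ (r ℕ.+ r)))       ≡⟨ solve 2 (λ a b → a :- (a :- b) := b) refl σ _ ⟩
    P (m ℕ.+ (r ℕ.+ r))                 ≡⟨ middle-even r (ℕₚ.<⇒≤ r<s) ⟩
    P m                                 ∎
    where
    2r+1<c : suc (r ℕ.+ r) < c
    2r+1<c = subst (_≤ c) (cong suc (ℕₚ.+-suc r r)) (ℕₚ.+-mono-≤ r<s r<s)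

  P[m+c]≡P[m] : P (m ℕ.+ c) ≡ P m
  P[m+c]≡P[m] = middle-even s ℕₚ.≤-refl

  P1≡P[m] : 0 < m → P 1 ≡ P m
  P1≡P[m] 0<m = begin
    P 1                  ≡⟨ ℚₚ.+-identityˡ (P 1) ⟨
    0ℚ + P 1             ≡⟨ cong (_+ P 1) P0≡0 ⟨
    P 0 + P 1            ≡⟨ relations (first 0<m) ⟩
    P (m ℕ.+ c ℕ.+ 0)    ≡⟨ cong P (ℕₚ.+-identityʳ (m ℕ.+ c)) ⟩
    P (m ℕ.+ c)          ≡⟨ P[m+c]≡P[m] ⟩
    P m                  ∎

  -- The rows j and j + 1 express P(m+c+j) and P(m+c+j+1) by values in the first block, and row m +
  -- c + j says that these two add up to σ + P(j+1). One copy of P(j+1) cancels.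
  P-threeTerm : ∀ {j} → suc j < m → P j + P (suc j) + P (suc (suc j)) ≡ σ
  P-threeTerm {j} j+1<m = threeTerm {P j}
    (relations (first j<m))
    (trans (relations (first j+1<m)) (cong P (ℕₚ.+-suc (m ℕ.+ c) j)))
    (relations (last j<m))
    where
    j<m = ℕₚ.<-trans (ℕₚ.n<1+n j) j+1<m

  -- Row m - 1 gives P(m-1) + P(m) = P(n-1), and the last row gives P(n-1) + P(n) = σ + P(m), where
  -- P(n) is σ.
  P[m-1]≡0 : ∀ {m′} → m ≡ suc m′ → P m′ ≡ 0ℚ
  P[m-1]≡0 {m′} refl = begin
    P m′                                 ≡⟨ solve 3 (λ a b σ → a := (a :+ b) :+ σ :- (σ :+ b)) refl (P m′) (P m) σ ⟩
    P m′ + P m + σ - (σ + P m)           ≡⟨ cong (λ z → z + σ - (σ + P m)) (relations (first (ℕₚ.n<1+n m′))) ⟩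
    P (m ℕ.+ c ℕ.+ m′) + σ - (σ + P m)   ≡⟨ cong (λ z → P (m ℕ.+ c ℕ.+ m′) + z - (σ + P m))
                                              (trans (cong P (sym (ℕₚ.+-suc (m ℕ.+ c) m′))) Pn≡σ) ⟨
    P (m ℕ.+ c ℕ.+ m′) + P (suc (m ℕ.+ c ℕ.+ m′)) - (σ + P m)
                                         ≡⟨ cong (_- (σ + P m)) (relations (last (ℕₚ.n<1+n m′))) ⟩
    σ + P m - (σ + P m)                  ≡⟨ ℚₚ.+-inverseʳ (σ + P m) ⟩
    0ℚ                                   ∎

  P≡π : ∀ j → suc j ≤ m → P j ≡ π (P 1) σ j × P (suc j) ≡ π (P 1) σ (suc j)
  P≡π zero    _     = P0≡0 , refl
  P≡π (suc j) j+1<m with Pj≡ , Pj+1≡ ← P≡π j (ℕₚ.<⇒≤ j+1<m) = Pj+1≡ , (begin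
    P (suc (suc j))                      ≡⟨ solveʳ (P-threeTerm j+1<m) ⟩
    σ - (P j + P (suc j))                ≡⟨ cong₂ (λ a b → σ - (a + b)) Pj≡ Pj+1≡ ⟩
    σ - (π′ j + π′ (suc j))              ≡⟨ solveʳ (π-threeTerm (P 1) σ j) ⟨
    π′ (suc (suc j))                     ∎)
    where π′ = π (P 1) σ

  -- The last entry of the vector is P(n) - P(n-1); this identity makes P(n) the sum of the first
  -- and the last entry, so that these two can serve as coordinates on the kernel.
  P[n-1]≡P1 : ∀ {m′} → m ≡ suc m′ → P (m ℕ.+ c ℕ.+ m′) ≡ P 1
  P[n-1]≡P1 {m′} refl = begin
    P (m ℕ.+ c ℕ.+ m′)   ≡⟨ relations (first (ℕₚ.n<1+n m′)) ⟨
    P m′ + P m           ≡⟨ cong₂ _+_ (P[m-1]≡0 refl) (sym (P1≡P[m] (s≤s z≤n))) ⟩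
    0ℚ + P 1             ≡⟨ ℚₚ.+-identityˡ (P 1) ⟩
    P 1                  ∎

  -- The condition on P(1) is restricted to positive m: for m = 0 the first block is empty and the
  -- middle block starts from P(0) = 0.
  module Vanishing (P1≡0 : 0 < m → P 1 ≡ 0ℚ) (σ≡0 : σ ≡ 0ℚ) where

    vanish-first : ∀ i → i ≤ m → P i ≡ 0ℚ
    vanish-first zero          _     = P0≡0
    vanish-first (suc zero)    0<m   = P1≡0 0<m
    vanish-first (suc (suc i)) i+1<m = trans (solveʳ (P-threeTerm i+1<m))
      (trans (cong₂ (λ a b → a - b) σ≡0
        (0+0 (vanish-first i (ℕₚ.<⇒≤ (ℕₚ.<⇒≤ i+1<m))) (vanish-first (suc i) (ℕₚ.<⇒≤ i+1<m)))) refl)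

    vanish-middle : ∀ j → j ≤ c → P (m ℕ.+ j) ≡ 0ℚ
    vanish-middle zero    _   = trans (cong P (ℕₚ.+-identityʳ m)) (vanish-first m ℕₚ.≤-refl)
    vanish-middle (suc j) j<c = trans (middle-step j<c)
      (cong₂ (λ a b → a - b) σ≡0 (vanish-middle j (ℕₚ.<⇒≤ j<c)))

    vanish-last : ∀ j → j < m → P (m ℕ.+ c ℕ.+ j) ≡ 0ℚ
    vanish-last j j<m = trans (sym (relations (first j<m))) (0+0 (vanish-first j (ℕₚ.<⇒≤ j<m)) (vanish-first (suc j) j<m))

    vanish : ∀ {i} → Block m c i → P i ≡ 0ℚ
    vanish (first i<m)  = vanish-first _ (ℕₚ.<⇒≤ i<m)
    vanish (middle j<c) = vanish-middle _ (ℕₚ.<⇒≤ j<c)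
    vanish (last j<m)   = vanish-last _ j<m

    vanish-≤ : ∀ q → q ≤ m ℕ.+ c ℕ.+ m → P q ≡ 0ℚ
    vanish-≤ q q≤n with q ℕₚ.<? m ℕ.+ c ℕ.+ m
    ... | yes q<n = vanish (block m c q q<n)
    ... | no q≮n  = trans (cong P (ℕₚ.≤-antisym q≤n (ℕₚ.≮⇒≥ q≮n))) (trans Pn≡σ σ≡0)

-- Multiplicities from coefficients

coeff-*-0∷ : ∀ p q i → coeff (p *ₚ (0ℤ ∷ q)) (suc i) ≡ coeff (p *ₚ q) i
coeff-*-0∷ []      q i       = refl
coeff-*-0∷ (a ∷ p) q zero    = begin
  coeff ((a ∷ p) *ₚ (0ℤ ∷ q)) 1                        ≡⟨ coeff-*-one (a ∷ p) (0ℤ ∷ q) ⟩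
  a ℤ.* coeff q 0 ℤ.+ coeff p 0 ℤ.* 0ℤ                 ≡⟨ cong (λ z → a ℤ.* coeff q 0 ℤ.+ z) (ℤₚ.*-zeroʳ (coeff p 0)) ⟩
  a ℤ.* coeff q 0 ℤ.+ 0ℤ                               ≡⟨ ℤₚ.+-identityʳ _ ⟩
  a ℤ.* coeff q 0                                      ≡⟨ coeff-*-zero (a ∷ p) q ⟨
  coeff ((a ∷ p) *ₚ q) 0                               ∎
  where open ≡-Reasoning
coeff-*-0∷ (a ∷ p) q (suc i) = begin
  coeff ((a ∷ p) *ₚ (0ℤ ∷ q)) (suc (suc i))                  ≡⟨ coeff-∷-*-suc a p (0ℤ ∷ q) (suc i) ⟩
  a ℤ.* coeff q (suc i) ℤ.+ coeff (p *ₚ (0ℤ ∷ q)) (suc i)    ≡⟨ cong (λ z → a ℤ.* coeff q (suc i) ℤ.+ z) (coeff-*-0∷ p q i) ⟩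
  a ℤ.* coeff q (suc i) ℤ.+ coeff (p *ₚ q) i                 ≡⟨ coeff-∷-*-suc a p q i ⟨
  coeff ((a ∷ p) *ₚ q) (suc i)                               ∎
  where open ≡-Reasoning

coeff-*-1 : ∀ p i → coeff (p *ₚ (1ℤ ∷ [])) i ≡ coeff p i
coeff-*-1 []      i       = refl
coeff-*-1 (a ∷ p) zero    = trans (coeff-*-zero (a ∷ p) (1ℤ ∷ [])) (ℤₚ.*-identityʳ a)
coeff-*-1 (a ∷ p) (suc i) = begin
  coeff ((a ∷ p) *ₚ (1ℤ ∷ [])) (suc i)          ≡⟨ coeff-∷-*-suc a p (1ℤ ∷ []) i ⟩
  a ℤ.* 0ℤ ℤ.+ coeff (p *ₚ (1ℤ ∷ [])) i         ≡⟨ cong₂ ℤ._+_ (ℤₚ.*-zeroʳ a) (coeff-*-1 p i) ⟩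
  0ℤ ℤ.+ coeff p i                              ≡⟨ ℤₚ.+-identityˡ _ ⟩
  coeff p i                                     ∎
  where open ≡-Reasoning

coeff-drop : ∀ n p i → coeff (drop n p) i ≡ coeff p (n ℕ.+ i)
coeff-drop zero    p       i = refl
coeff-drop (suc n) []      i = refl
coeff-drop (suc n) (a ∷ p) i = coeff-drop n p i

-- Powers of `X- 0ℤ` evaluate to literal lists such as `0ℤ ∷ 0ℤ ∷ 1ℤ ∷ []`, so divisibility by them
-- can be read off from coefficients.
multiplicity-0 : ∀ p → coeff p 0 ≢ 0ℤ → IsZeroOfMultiplicity p 0ℤ 0
multiplicity-0 p p₀≢0 =
  (p RawMagmaDefs., coeff-*-1 p) ,
  λ { (q RawMagmaDefs., qX≈p) → p₀≢0 (begin
    coeff p 0                        ≡⟨ qX≈p 0 ⟨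
    coeff (q *ₚ (0ℤ ∷ 1ℤ ∷ [])) 0    ≡⟨ coeff-*-zero q (0ℤ ∷ 1ℤ ∷ []) ⟩
    coeff q 0 ℤ.* 0ℤ                 ≡⟨ ℤₚ.*-zeroʳ (coeff q 0) ⟩
    0ℤ                               ∎) }
  where open ≡-Reasoning

multiplicity-2 : ∀ p → coeff p 0 ≡ 0ℤ → coeff p 1 ≡ 0ℤ → coeff p 2 ≢ 0ℤ → IsZeroOfMultiplicity p 0ℤ 2
multiplicity-2 p p₀≡0 p₁≡0 p₂≢0 = (q RawMagmaDefs., qX²≈p) ,
  λ { (r RawMagmaDefs., rX³≈p) → p₂≢0 (begin
    coeff p 2                                ≡⟨ rX³≈p 2 ⟨
    coeff (r *ₚ (0ℤ ∷ 0ℤ ∷ 0ℤ ∷ 1ℤ ∷ [])) 2  ≡⟨ coeff-*-0∷ r (0ℤ ∷ 0ℤ ∷ 1ℤ ∷ []) 1 ⟩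
    coeff (r *ₚ (0ℤ ∷ 0ℤ ∷ 1ℤ ∷ [])) 1       ≡⟨ coeff-*-0∷ r (0ℤ ∷ 1ℤ ∷ []) 0 ⟩
    coeff (r *ₚ (0ℤ ∷ 1ℤ ∷ [])) 0            ≡⟨ coeff-*-zero r (0ℤ ∷ 1ℤ ∷ []) ⟩
    coeff r 0 ℤ.* 0ℤ                         ≡⟨ ℤₚ.*-zeroʳ (coeff r 0) ⟩
    0ℤ                                       ∎) }
  where
  open ≡-Reasoning
  q = drop 2 p

  qX²≈p : ∀ i → coeff (q *ₚ (0ℤ ∷ 0ℤ ∷ 1ℤ ∷ [])) i ≡ coeff p i
  qX²≈p 0 = trans (coeff-*-zero q (0ℤ ∷ 0ℤ ∷ 1ℤ ∷ [])) (trans (ℤₚ.*-zeroʳ (coeff q 0)) (sym p₀≡0))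
  qX²≈p 1 = trans (coeff-*-0∷ q (0ℤ ∷ 1ℤ ∷ []) 0)
    (trans (coeff-*-zero q (0ℤ ∷ 1ℤ ∷ [])) (trans (ℤₚ.*-zeroʳ (coeff q 0)) (sym p₁≡0)))
  qX²≈p (suc (suc i)) = begin
    coeff (q *ₚ (0ℤ ∷ 0ℤ ∷ 1ℤ ∷ [])) (suc (suc i))   ≡⟨ coeff-*-0∷ q (0ℤ ∷ 1ℤ ∷ []) (suc i) ⟩
    coeff (q *ₚ (0ℤ ∷ 1ℤ ∷ [])) (suc i)              ≡⟨ coeff-*-0∷ q (1ℤ ∷ []) i ⟩
    coeff (q *ₚ (1ℤ ∷ [])) i                         ≡⟨ coeff-*-1 q i ⟩
    coeff q i                                        ≡⟨ coeff-drop 2 p i ⟩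
    coeff p (suc (suc i))                            ∎

truncate-D : ∀ n k → truncate (D n k) ≡ Determinant.∣_∣ jetRing (pencil (A₀ n k) (B n k))
truncate-D n k = trans (det-homo (A ℤ[X] n k X))
  (Determinant.det-cong jetRing λ i j → trans (A-homo n k X i j) (A-jet n k i j))
  where open Homomorphism ℤ[X] jetRing truncate-homo

-- The kernel of A(n,k,0)

A₀-skew : ∀ n k i j → A₀ n k i j ≡ - A₀ n k j i
A₀-skew n k i j = skewToeplitz-skew (step k 1ℚ 0ℚ) (toℕ i) (toℕ j)

B-skew : ∀ n k i j → B n k i j ≡ - B n k j i
B-skew n k i j = skewToeplitz-skew (step k 0ℚ (- 1ℚ)) (toℕ i) (toℕ j)

-- `A₀ n k` stands for the matrix at x = 0 definitionally, because `- 0ℚ` evaluates to `0ℚ`.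
N-unique : ∀ n k {d} → HasDimension (Kernel (A₀ n k)) d → N n k ≡ d
N-unique n k = nullity-unique (A ℚ.+-*-rawRing n k 0ℚ)

block-< : ∀ {m c i} → Block m c i → i < m ℕ.+ c ℕ.+ m
block-< {m} {c} (first i<m)      = ℕₚ.<-≤-trans i<m (ℕₚ.m≤n+m m (m ℕ.+ c))
block-< {m} {c} (middle {j} j<c) = ℕₚ.<-≤-trans (ℕₚ.+-monoʳ-< m j<c) (ℕₚ.m≤m+n (m ℕ.+ c) m)
block-< {m} {c} (last {j} j<m)   = ℕₚ.+-monoʳ-< (m ℕ.+ c) j<m

module KernelRelations (m c k : ℕ) (k+1≡m+c : suc k ≡ m ℕ.+ c) where
  open ≡-Reasoning

  n : ℕ
  n = m ℕ.+ c ℕ.+ m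

  module _ (v : Vector ℚ n) where
    private
      P = prefix v

    target-prefix : ∀ {i} (b : Block m c i) → P (i ℕ.+ suc k) + P (i ∸ k) ≡ target m c P (sum v) b
    target-prefix = target-≡ m c P (sum v) k k+1≡m+c (prefix-zero v) (prefix-≥ v)

    A₀-row-target : ∀ i (b : Block m c (toℕ i)) →
      A₀ n k i ∙ v ≡ target m c P (sum v) b - (P (toℕ i) + P (suc (toℕ i)))
    A₀-row-target i b = begin
      A₀ n k i ∙ v
        ≡⟨ A₀-row k v i ⟩
      P (toℕ i ℕ.+ suc k) - P (suc (toℕ i)) - P (toℕ i) + P (toℕ i ∸ k)
        ≡⟨ solve 4 (λ a b c d → a :- b :- c :+ d := (a :+ d) :- (c :+ b)) refl
             (P (toℕ i ℕ.+ suc k)) (P (suc (toℕ i))) (P (toℕ i)) (P (toℕ i ∸ k)) ⟩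
      P (toℕ i ℕ.+ suc k) + P (toℕ i ∸ k) - (P (toℕ i) + P (suc (toℕ i)))
        ≡⟨ cong (_- (P (toℕ i) + P (suc (toℕ i)))) (target-prefix b) ⟩
      target m c P (sum v) b - (P (toℕ i) + P (suc (toℕ i))) ∎

    relations⇒kernel : Relations m c P (sum v) → Kernel (A₀ n k) v
    relations⇒kernel relations i = begin
      A₀ n k i ∙ v                                              ≡⟨ A₀-row-target i b ⟩
      target m c P (sum v) b - (P (toℕ i) + P (suc (toℕ i)))    ≡⟨ cong (λ z → target m c P (sum v) b - z) (relations b) ⟩
      target m c P (sum v) b - target m c P (sum v) b           ≡⟨ ℚₚ.+-inverseʳ (target m c P (sum v) b) ⟩
      0ℚ                                                        ∎
      where b = block m c (toℕ i) (toℕ<n i)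

    kernel⇒relations : Kernel (A₀ n k) v → Relations m c P (sum v)
    kernel⇒relations A₀v≡0 {i} b = go b (fromℕ< (block-< b)) (toℕ-fromℕ< (block-< b))
      where
      go : ∀ {i} (b : Block m c i) (i′ : Fin n) → toℕ i′ ≡ i → P i + P (suc i) ≡ target m c P (sum v) b
      go b i′ refl = begin
        s              ≡⟨ solve 2 (λ s t → s := t :- (t :- s)) refl s t ⟩
        t - (t - s)    ≡⟨ cong (λ z → t - z) (trans (sym (A₀-row-target i′ b)) (A₀v≡0 i′)) ⟩
        t - 0ℚ         ≡⟨ solve 1 (λ t → t :- con 0ℚ := t) refl t ⟩
        t              ∎
        where
        s = P (toℕ i′) + P (suc (toℕ i′))
        t = target m c P (sum v) b

    -- The rows of A₀ and B share the terms P(i+k+1) and P(i-k), and on the kernel their sum is P(i)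
    -- + P(i+1).
    B-row-kernel : Kernel (A₀ n k) v → ∀ i → B n k i ∙ v ≡ P (toℕ i) + P (suc (toℕ i)) - sum v
    B-row-kernel A₀v≡0 i = begin
      B n k i ∙ v                                       ≡⟨ B-row k v i ⟩
      P (toℕ i ℕ.+ suc k) - sum v + P (toℕ i ∸ k)
        ≡⟨ solve 3 (λ a b c → a :- b :+ c := a :+ c :- b) refl (P (toℕ i ℕ.+ suc k)) (sum v) (P (toℕ i ∸ k)) ⟩
      P (toℕ i ℕ.+ suc k) + P (toℕ i ∸ k) - sum v
        ≡⟨ cong (_- sum v) (trans (target-prefix b) (sym (kernel⇒relations A₀v≡0 b))) ⟩
      P (toℕ i) + P (suc (toℕ i)) - sum v               ∎
      where b = block m c (toℕ i) (toℕ<n i)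

    prefix-difference : ∀ i → v i ≡ P (suc (toℕ i)) - P (toℕ i)
    prefix-difference i = trans
      (solve 2 (λ a b → a := b :+ a :- b) refl (v i) (P (toℕ i)))
      (cong (_- P (toℕ i)) (sym (prefix-suc v i)))

module TrivialKernel (m s k : ℕ) (k+1≡m+c : suc k ≡ m ℕ.+ (s ℕ.+ s)) where
  open KernelRelations m (s ℕ.+ s) k k+1≡m+c public

  module _ (v : Vector ℚ n) (A₀v≡0 : Kernel (A₀ n k) v) where
    open Solutions {m} {s} (kernel⇒relations v A₀v≡0) (prefix-zero v) (prefix-≥ v n ℕₚ.≤-refl) public

  vanishing : ∀ v → Kernel (A₀ n k) v → (0 < m → prefix v 1 ≡ 0ℚ) → sum v ≡ 0ℚ → ∀ i → v i ≡ 0ℚ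
  vanishing v A₀v≡0 P1≡0 σ≡0 i = trans (prefix-difference v i)
    (cong₂ _-_ (vanish-≤ (suc (toℕ i)) (toℕ<n i)) (vanish-≤ (toℕ i) (ℕₚ.<⇒≤ (toℕ<n i))))
    where open Vanishing v A₀v≡0 P1≡0 σ≡0

  trivial⇒multiplicity : (∀ v → Kernel (A₀ n k) v → ∀ i → v i ≡ 0ℚ) →
                         IsZeroOfMultiplicity (D n k) 0ℤ (N n k)
  trivial⇒multiplicity trivial = subst (IsZeroOfMultiplicity (D n k) 0ℤ)
    (sym (N-unique n k {0} ((λ ()) , record
      { member = λ () ; independent = λ _ _ () ; spanning = λ v v∈ → (λ ()) , λ j → sym (trivial v v∈ j) })))
    (multiplicity-0 (D n k) λ D₀≡0 → det≢0 (begin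
      ∣ A₀ n k ∣
        ≡⟨ Homomorphism.det-homo jetRawRing ℚₚ.+-*-commutativeRing c₀-homo (pencil (A₀ n k) (B n k)) ⟨
      c₀ (Determinant.∣_∣ jetRing (pencil (A₀ n k) (B n k)))   ≡⟨ cong c₀ (truncate-D n k) ⟨
      fromℤ (coeff (D n k) 0)                                  ≡⟨ cong fromℤ D₀≡0 ⟩
      0ℚ                                                       ∎))
    where
    open ≡-Reasoning
    det≢0 : ∣ A₀ n k ∣ ≢ 0ℚ
    det≢0 = independentRows⇒det≢0 (A₀ n k) λ w wA₀≡0 →
      trivial w (SkewForm.linComb≡0⇒kernel (A₀ n k) (A₀-skew n k) w wA₀≡0)

-- Explicit kernel vectors for m ≡ 1 mod 3

splice : ℕ → (ℕ → ℚ) → (ℕ → ℚ) → ℕ → ℚ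
splice zero    f g i       = g i
splice (suc m) f g zero    = f zero
splice (suc m) f g (suc i) = splice m (f ∘ suc) g i

splice-+ : ∀ m f g i → splice m f g (m ℕ.+ i) ≡ g i
splice-+ zero    f g i = refl
splice-+ (suc m) f g i = splice-+ m (f ∘ suc) g i

-- Since the pieces agree at the joint, the first formula holds at `m` too. This matters because the
-- equation of row i involves P(i+1), which for the last row of a block lies in the next piece.
splice-≤ : ∀ m f g → f m ≡ g 0 → ∀ {i} → i ≤ m → splice m f g i ≡ f i
splice-≤ zero    f g fm≡g0 z≤n         = sym fm≡g0
splice-≤ (suc m) f g fm≡g0 {zero}  i≤m = refl
splice-≤ (suc m) f g fm≡g0 {suc i} i≤m = splice-≤ m (f ∘ suc) g fm≡g0 (ℕ.s≤s⁻¹ i≤m)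

module _ (p σ : ℚ) where

  alternating : ℕ → ℚ
  alternating 0             = p
  alternating 1             = σ - p
  alternating (suc (suc j)) = alternating j

  alternating-even : ∀ s → alternating (s ℕ.+ s) ≡ p
  alternating-even zero    = refl
  alternating-even (suc s) = trans (cong (λ z → alternating (suc z)) (ℕₚ.+-suc s s)) (alternating-even s)

  alternating-suc : ∀ j → alternating j + alternating (suc j) ≡ σ
  alternating-suc 0             = solve 2 (λ p σ → p :+ (σ :- p) := σ) refl p σ
  alternating-suc 1             = solve 2 (λ p σ → (σ :- p) :+ p := σ) refl p σ
  alternating-suc (suc (suc j)) = alternating-suc j

  -- The values on the last block, forced by the rows of the first block.
  π₂ : ℕ → ℚ
  π₂ j = π p σ j + π p σ (suc j)

  π₂-suc : ∀ j → π₂ j + π₂ (suc j) ≡ σ + π p σ (suc j)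
  π₂-suc j = trans
    (solve 3 (λ a b c → (a :+ b) :+ (b :+ c) := (a :+ b :+ c) :+ b) refl
      (π p σ j) (π p σ (suc j)) (π p σ (suc (suc j))))
    (cong (_+ π p σ (suc j)) (π-threeTerm p σ j))

module _ (t s : ℕ) where
  private
    m c n : ℕ
    m = suc (t ℕ.* 3)
    c = s ℕ.+ s
    n = m ℕ.+ c ℕ.+ m

  module _ (p σ : ℚ) where
    private
      G₃ G₂ : ℕ → ℚ
      G₃ = splice m (π₂ p σ) (const σ)
      G₂ = splice c (alternating p σ) G₃

    -- The pieces fit together at three joints. At m and n this uses m ≡ 1 mod 3, by which π(m) = p
    -- and π(m) + π(m+1) = σ; at m + c it uses that c is even, by which the alternating piece
    -- returns to p.
    Π : ℕ → ℚ
    Π = splice m (π p σ) G₂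

    private
      π₂m≡σ : π₂ p σ m ≡ σ
      π₂m≡σ = trans (cong₂ _+_ (π-3t+1 p σ t) (π-3t+2 p σ t))
        (solve 2 (λ p σ → p :+ (σ :- p) := σ) refl p σ)

      G₃0≡p : G₃ 0 ≡ p
      G₃0≡p = trans (splice-≤ m (π₂ p σ) (const σ) π₂m≡σ {0} z≤n) (ℚₚ.+-identityˡ p)

      alternating-c : alternating p σ c ≡ G₃ 0
      alternating-c = trans (alternating-even p σ s) (sym G₃0≡p)

      πm≡G₂0 : π p σ m ≡ G₂ 0
      πm≡G₂0 = trans (π-3t+1 p σ t) (sym (splice-≤ c (alternating p σ) G₃ alternating-c z≤n))

    Π-first : ∀ {i} → i ≤ m → Π i ≡ π p σ i
    Π-first = splice-≤ m (π p σ) G₂ πm≡G₂0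

    Π-middle : ∀ {j} → j ≤ c → Π (m ℕ.+ j) ≡ alternating p σ j
    Π-middle {j} j≤c = trans (splice-+ m (π p σ) G₂ j) (splice-≤ c (alternating p σ) G₃ alternating-c j≤c)

    Π-G₃ : ∀ j → Π (m ℕ.+ c ℕ.+ j) ≡ G₃ j
    Π-G₃ j = trans (cong Π (ℕₚ.+-assoc m c j))
      (trans (splice-+ m (π p σ) G₂ (c ℕ.+ j)) (splice-+ c (alternating p σ) G₃ j))

    Π-last : ∀ {j} → j ≤ m → Π (m ℕ.+ c ℕ.+ j) ≡ π₂ p σ j
    Π-last {j} j≤m = trans (Π-G₃ j) (splice-≤ m (π₂ p σ) (const σ) π₂m≡σ j≤m)

    Π-≥ : ∀ q → n ≤ q → Π q ≡ σ
    Π-≥ q n≤q with j , refl ← ℕₚ.m≤n⇒∃[o]m+o≡n n≤q = trans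
      (cong Π (ℕₚ.+-assoc (m ℕ.+ c) m j))
      (trans (Π-G₃ (m ℕ.+ j)) (splice-+ m (π₂ p σ) (const σ) j))

    Π-middle-suc : ∀ {j} → j < c → Π (suc (m ℕ.+ j)) ≡ alternating p σ (suc j)
    Π-middle-suc {j} j<c = trans (cong Π (sym (ℕₚ.+-suc m j))) (Π-middle j<c)

    Π-last-suc : ∀ {j} → j < m → Π (suc (m ℕ.+ c ℕ.+ j)) ≡ π₂ p σ (suc j)
    Π-last-suc {j} j<m = trans (cong Π (sym (ℕₚ.+-suc (m ℕ.+ c) j))) (Π-last j<m)

    Π-relations : Relations m c Π σ
    Π-relations (first i<m) = trans
      (cong₂ _+_ (Π-first (ℕₚ.<⇒≤ i<m)) (Π-first i<m))
      (sym (Π-last (ℕₚ.<⇒≤ i<m)))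
    Π-relations (middle {j} j<c) = trans
      (cong₂ _+_ (Π-middle (ℕₚ.<⇒≤ j<c)) (Π-middle-suc j<c))
      (alternating-suc p σ j)
    Π-relations (last {j} j<m) = trans
      (cong₂ _+_ (Π-last (ℕₚ.<⇒≤ j<m)) (Π-last-suc j<m))
      (trans (π₂-suc p σ j) (cong (σ +_) (sym (Π-first j<m))))

    solution : Vector ℚ n
    solution = differences n Π

    sum-solution : sum solution ≡ σ
    sum-solution = trans (sym (prefix-≥ solution n ℕₚ.≤-refl))
      (trans (prefix-differences n Π refl n ℕₚ.≤-refl) (Π-≥ n ℕₚ.≤-refl))

    prefix-solution : ∀ q → prefix solution q ≡ Π q
    prefix-solution q with q ℕₚ.≤? n
    ... | yes q≤n = prefix-differences n Π refl q q≤n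
    ... | no q≰n  = trans (prefix-≥ solution q n≤q) (trans sum-solution (sym (Π-≥ q n≤q)))
      where n≤q = ℕₚ.<⇒≤ (ℕₚ.≰⇒> q≰n)

    private
      target-solution : ∀ {i} (b : Block m c i) →
        target m c Π σ b ≡ target m c (prefix solution) (sum solution) b
      target-solution (first {i} _) = sym (prefix-solution (m ℕ.+ c ℕ.+ i))
      target-solution (middle _)    = sym sum-solution
      target-solution (last {j} _)  = sym (cong₂ _+_ sum-solution (prefix-solution (suc j)))

    solution-relations : Relations m c (prefix solution) (sum solution)
    solution-relations {i} b = trans (cong₂ _+_ (prefix-solution i) (prefix-solution (suc i)))
      (trans (Π-relations b) (target-solution b))

  module NontrivialKernel (k : ℕ) (k+1≡m+c : suc k ≡ m ℕ.+ c) where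
    open TrivialKernel m s k k+1≡m+c hiding (n; c)
    open SkewForm (A₀ n k) (A₀-skew n k) using (kernel⇒linComb≡0; linComb≡0⇒kernel)
    open SkewForm (B n k) (B-skew n k) using (form; form-skew; form-alternating)
    open ≡-Reasoning

    final : Fin n
    final = fromℕ (t ℕ.* 3 ℕ.+ c ℕ.+ m)

    private
      toℕ-final : toℕ final ≡ m ℕ.+ c ℕ.+ t ℕ.* 3
      toℕ-final = trans (toℕ-fromℕ (t ℕ.* 3 ℕ.+ c ℕ.+ m)) (ℕₚ.+-suc (t ℕ.* 3 ℕ.+ c) (t ℕ.* 3))

    zero≢final : zero ≢ final
    zero≢final eq with () ← trans (cong toℕ eq) toℕ-final

    solution-kernel : ∀ p σ → Kernel (A₀ n k) (solution p σ)
    solution-kernel p σ = relations⇒kernel (solution p σ) (solution-relations p σ)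

    prefix-1 : ∀ (v : Vector ℚ n) → prefix v 1 ≡ v zero
    prefix-1 v = trans (prefix-suc v zero) (trans (cong (_+ v zero) (prefix-zero v)) (ℚₚ.+-identityˡ (v zero)))

    sum-kernel : ∀ v → Kernel (A₀ n k) v → sum v ≡ v zero + v final
    sum-kernel v A₀v≡0 = begin
      sum v                                                     ≡⟨ prefix-≥ v n ℕₚ.≤-refl ⟨
      prefix v n                                                ≡⟨ cong (prefix v ∘ suc) (toℕ-fromℕ (t ℕ.* 3 ℕ.+ c ℕ.+ m)) ⟨
      prefix v (suc (toℕ final))                                ≡⟨ prefix-suc v final ⟩
      prefix v (toℕ final) + v final                            ≡⟨ cong (λ q → prefix v q + v final) toℕ-final ⟩
      prefix v (m ℕ.+ c ℕ.+ t ℕ.* 3) + v final                  ≡⟨ cong (_+ v final) (P[n-1]≡P1 v A₀v≡0 refl) ⟩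
      prefix v 1 + v final                                      ≡⟨ cong (_+ v final) (prefix-1 v) ⟩
      v zero + v final                                          ∎

    determined : ∀ v → Kernel (A₀ n k) v → v zero ≡ 0ℚ → v final ≡ 0ℚ → ∀ i → v i ≡ 0ℚ
    determined v A₀v≡0 v₀≡0 vₑ≡0 = vanishing v A₀v≡0
      (λ _ → trans (prefix-1 v) v₀≡0)
      (trans (sum-kernel v A₀v≡0) (cong₂ _+_ v₀≡0 vₑ≡0))

    solution-zero : ∀ p σ → solution p σ zero ≡ p
    solution-zero p σ = trans (sym (prefix-1 (solution p σ)))
      (trans (prefix-solution p σ 1) (Π-first p σ (s≤s z≤n)))

    solution-final : ∀ p σ → solution p σ final ≡ σ - p
    solution-final p σ = begin
      w final                        ≡⟨ solve 2 (λ a b → b := a :+ b :- a) refl (w zero) (w final) ⟩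
      w zero + w final - w zero      ≡⟨ cong₂ _-_ (trans (sym (sum-kernel w (solution-kernel p σ))) (sum-solution p σ))
                                          (solution-zero p σ) ⟩
      σ - p                          ∎
      where w = solution p σ

    -- `solution p σ` has first entry p and last entry σ - p, so these parameters give the basis
    -- dual to the first and last coordinates.
    u v : Vector ℚ n
    u = solution 1ℚ 1ℚ
    v = solution 0ℚ 1ℚ

    b : Fin 2 → Vector ℚ n
    b zero       = u
    b (suc zero) = v

    b-kernel : ∀ i → Kernel (A₀ n k) (b i)
    b-kernel zero       = solution-kernel 1ℚ 1ℚ
    b-kernel (suc zero) = solution-kernel 0ℚ 1ℚ

    linComb-b-zero : ∀ a → linComb a b zero ≡ a zero
    linComb-b-zero a = trans
      (cong₂ (λ y z → a zero * y + (a (suc zero) * z + 0ℚ)) (solution-zero 1ℚ 1ℚ) (solution-zero 0ℚ 1ℚ))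
      (solve 2 (λ a b → a :* con 1ℚ :+ (b :* con 0ℚ :+ con 0ℚ) := a) refl (a zero) (a (suc zero)))

    linComb-b-final : ∀ a → linComb a b final ≡ a (suc zero)
    linComb-b-final a = trans
      (cong₂ (λ y z → a zero * y + (a (suc zero) * z + 0ℚ)) (solution-final 1ℚ 1ℚ) (solution-final 0ℚ 1ℚ))
      (solve 2 (λ a b → a :* con 0ℚ :+ (b :* con 1ℚ :+ con 0ℚ) := b) refl (a zero) (a (suc zero)))

    b-basis : IsBasis (Kernel (A₀ n k)) b
    b-basis = record
      { member      = b-kernel
      ; independent = λ where
          a a≡0 zero       → trans (sym (linComb-b-zero a)) (a≡0 zero)
          a a≡0 (suc zero) → trans (sym (linComb-b-final a)) (a≡0 final)
      ; spanning    = λ w w∈ → coordinates w , λ j → -‿≡0 (spanned w w∈ j)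
      }
      where
      coordinates : Vector ℚ n → Vector ℚ 2
      coordinates w zero       = w zero
      coordinates w (suc zero) = w final

      -‿≡0 : ∀ {a b} → b - a ≡ 0ℚ → a ≡ b
      -‿≡0 {a} {b} e = trans (solve 2 (λ a b → a := b :- (b :- a)) refl a b)
        (trans (cong (λ z → b - z) e) (solve 1 (λ b → b :- con 0ℚ := b) refl b))

      ∙-sub : ∀ {n} (r x y : Vector ℚ n) → r ∙ (λ j → x j - y j) ≡ r ∙ x - r ∙ y
      ∙-sub {zero}  r x y = refl
      ∙-sub {suc n} r x y = trans (cong (r zero * (x zero - y zero) +_) (∙-sub (tail r) (tail x) (tail y)))
        (solve 5 (λ r x y a b → r :* (x :- y) :+ (a :- b) := (r :* x :+ a) :- (r :* y :+ b)) refl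
          (r zero) (x zero) (y zero) (tail r ∙ tail x) (tail r ∙ tail y))

      linComb-kernel : ∀ a → Kernel (A₀ n k) (linComb a b)
      linComb-kernel a = linComb≡0⇒kernel (linComb a b) λ j → trans (sym (linComb-linComb a b (A₀ n k) j))
        (sum-zero λ i → trans (cong (a i *_) (kernel⇒linComb≡0 (b i) (b-kernel i) j)) (ℚₚ.*-zeroʳ (a i)))

      spanned : ∀ w → Kernel (A₀ n k) w → ∀ j → w j - linComb (coordinates w) b j ≡ 0ℚ
      spanned w w∈ = determined (λ j → w j - linComb (coordinates w) b j)
        (λ i → trans (∙-sub (A₀ n k i) w (linComb (coordinates w) b))
          (cong₂ _-_ (w∈ i) (linComb-kernel (coordinates w) i)))
        (trans (cong (λ z → w zero - z) (linComb-b-zero (coordinates w))) (ℚₚ.+-inverseʳ (w zero)))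
        (trans (cong (λ z → w final - z) (linComb-b-final (coordinates w))) (ℚₚ.+-inverseʳ (w final)))

    private
      term : ℕ → ℚ
      term i = (Π 1ℚ 1ℚ (suc i) - Π 1ℚ 1ℚ i) * (Π 0ℚ 1ℚ i + Π 0ℚ 1ℚ (suc i) - 1ℚ)

      -- In the first block the prefix sums of `u` repeat 0, 1, 0 and those of `v` repeat 0, 0, 1,
      -- so the products repeat -1, 0, 0.
      first-≤0 : ∀ i → (π 1ℚ 1ℚ (suc i) - π 1ℚ 1ℚ i) * (π₂ 0ℚ 1ℚ i - 1ℚ) ℚ.≤ 0ℚ
      first-≤0 0 = from-yes (- 1ℚ ℚₚ.≤? 0ℚ)
      first-≤0 1 = ℚₚ.≤-refl
      first-≤0 2 = ℚₚ.≤-refl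
      first-≤0 (suc (suc (suc i))) = first-≤0 i

      -- In the last block the prefix sums repeat 1, 1, 0 for `u` and 0, 1, 1 for `v`, so the
      -- products repeat 0, -1, 0.
      last-≤0 : ∀ j → (π₂ 1ℚ 1ℚ (suc j) - π₂ 1ℚ 1ℚ j) * (π₂ 0ℚ 1ℚ j + π₂ 0ℚ 1ℚ (suc j) - 1ℚ) ℚ.≤ 0ℚ
      last-≤0 0 = ℚₚ.≤-refl
      last-≤0 1 = from-yes (- 1ℚ ℚₚ.≤? 0ℚ)
      last-≤0 2 = ℚₚ.≤-refl
      last-≤0 (suc (suc (suc j))) = last-≤0 j

      term-≡ : ∀ {i a b c d} → Π 1ℚ 1ℚ i ≡ a → Π 1ℚ 1ℚ (suc i) ≡ b → Π 0ℚ 1ℚ i ≡ c → Π 0ℚ 1ℚ (suc i) ≡ d →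
               term i ≡ (b - a) * (c + d - 1ℚ)
      term-≡ refl refl refl refl = refl

      term-≤0 : ∀ {i} → Block m c i → term i ℚ.≤ 0ℚ
      term-≤0 (first {i} i<m) = subst (ℚ._≤ 0ℚ)
        (sym (term-≡ (Π-first 1ℚ 1ℚ i≤m) (Π-first 1ℚ 1ℚ i<m) (Π-first 0ℚ 1ℚ i≤m) (Π-first 0ℚ 1ℚ i<m)))
        (first-≤0 i)
        where i≤m = ℕₚ.<⇒≤ i<m
      -- In the middle block the reflection P(i) + P(i+1) = σ says exactly that (Bv)ᵢ = 0.
      term-≤0 (middle {j} j<c) = ℚₚ.≤-reflexive (begin
        term (m ℕ.+ j)   ≡⟨ cong (λ z → y * (z - 1ℚ)) (Π-relations 0ℚ 1ℚ (middle j<c)) ⟩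
        y * 0ℚ           ≡⟨ ℚₚ.*-zeroʳ y ⟩
        0ℚ               ∎)
        where y = Π 1ℚ 1ℚ (suc (m ℕ.+ j)) - Π 1ℚ 1ℚ (m ℕ.+ j)
      term-≤0 (last {j} j<m) = subst (ℚ._≤ 0ℚ)
        (sym (term-≡ (Π-last 1ℚ 1ℚ j≤m) (Π-last-suc 1ℚ 1ℚ j<m) (Π-last 0ℚ 1ℚ j≤m) (Π-last-suc 0ℚ 1ℚ j<m)))
        (last-≤0 j)
        where j≤m = ℕₚ.<⇒≤ j<m

      sum-≤0 : ∀ {n} (f : Vector ℚ n) → (∀ i → f i ℚ.≤ 0ℚ) → sum f ℚ.≤ 0ℚ
      sum-≤0 {zero}  f f≤0 = ℚₚ.≤-refl
      sum-≤0 {suc n} f f≤0 = ℚₚ.+-mono-≤ (f≤0 zero) (sum-≤0 (tail f) (f≤0 ∘ suc))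

    uBv≡ : linComb u (B n k) ∙ v ≡ sum (λ (i : Fin n) → term (toℕ i))
    uBv≡ = trans (form u v) (sum-cong-≗ λ i → cong (u i *_) (begin
      B n k i ∙ v                                             ≡⟨ B-row-kernel v (solution-kernel 0ℚ 1ℚ) i ⟩
      prefix v (toℕ i) + prefix v (suc (toℕ i)) - sum v
        ≡⟨ cong₂ _-_ (cong₂ _+_ (prefix-solution 0ℚ 1ℚ (toℕ i)) (prefix-solution 0ℚ 1ℚ (suc (toℕ i))))
             (sum-solution 0ℚ 1ℚ) ⟩
      Π 0ℚ 1ℚ (toℕ i) + Π 0ℚ 1ℚ (suc (toℕ i)) - 1ℚ            ∎))

    uBv<0 : linComb u (B n k) ∙ v ℚ.< 0ℚ
    uBv<0 = subst (ℚ._< 0ℚ) (sym uBv≡)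
      (ℚₚ.+-mono-<-≤ term0<0 (sum-≤0 (λ i → term (suc (toℕ i))) λ i →
        term-≤0 (block m c (suc (toℕ i)) (s≤s (toℕ<n i)))))
      where
      term0<0 : term 0 ℚ.< 0ℚ
      term0<0 = subst (ℚ._< 0ℚ)
        (sym (term-≡ {0} (Π-first 1ℚ 1ℚ z≤n) (Π-first 1ℚ 1ℚ (s≤s z≤n)) (Π-first 0ℚ 1ℚ z≤n) (Π-first 0ℚ 1ℚ (s≤s z≤n))))
        (from-yes (- 1ℚ ℚₚ.<? 0ℚ))

    multiplicity : IsZeroOfMultiplicity (D n k) 0ℤ (N n k)
    multiplicity = subst (IsZeroOfMultiplicity (D n k) 0ℤ) (sym (N-unique n k (b , b-basis)))
      (multiplicity-2 (D n k)
        (fromℤ-injective (cong c₀ D≡)) (fromℤ-injective (cong c₁ D≡))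
        (λ D₂≡0 → det-C≢0
          (solution-kernel 1ℚ 1ℚ) (solution-kernel 0ℚ 1ℚ) (form-alternating u) (form-alternating v)
          uBv≢0 vBu≢0 (λ w wA₀≡0 → determined w (linComb≡0⇒kernel w wA₀≡0))
          (trans (sym (cong c₂ D≡)) (cong fromℤ D₂≡0))))
      where
      open Perturbation (A₀ n k) (B n k) zero≢final u v
        (solution-zero 1ℚ 1ℚ) (solution-final 0ℚ 1ℚ) (solution-zero 0ℚ 1ℚ)
        (kernel⇒linComb≡0 u (solution-kernel 1ℚ 1ℚ)) (kernel⇒linComb≡0 v (solution-kernel 0ℚ 1ℚ))

      D≡ : truncate (D n k) ≡ jet 0ℚ 0ℚ ∣ C ∣
      D≡ = trans (truncate-D n k) det-pencil

      uBv≢0 : linComb u (B n k) ∙ v ≢ 0ℚ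
      uBv≢0 = ℚₚ.<⇒≢ uBv<0

      vBu≢0 : linComb v (B n k) ∙ u ≢ 0ℚ
      vBu≢0 vBu≡0 = uBv≢0 (trans (form-skew u v) (cong -_ vBu≡0))

-- The cases modulo 3 and the theorem

data Mod3 : ℕ → Set where
  3t   : ∀ t → Mod3 (t ℕ.* 3)
  3t+1 : ∀ t → Mod3 (suc (t ℕ.* 3))
  3t+2 : ∀ t → Mod3 (suc (suc (t ℕ.* 3)))

mod3 : ∀ n → Mod3 n
mod3 0 = 3t 0
mod3 1 = 3t+1 0
mod3 2 = 3t+2 0
mod3 (suc (suc (suc n))) with mod3 n
... | 3t t   = 3t (suc t)
... | 3t+1 t = 3t+1 (suc t)
... | 3t+2 t = 3t+2 (suc t)

multiplicity-blocks : ∀ m s k → suc k ≡ m ℕ.+ (s ℕ.+ s) →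
  let n = m ℕ.+ (s ℕ.+ s) ℕ.+ m in IsZeroOfMultiplicity (D n k) 0ℤ (N n k)
-- For m = 0 there is only the middle block, of even length n, so the reflections carry P(0) = 0 to
-- P(n).
multiplicity-blocks zero s k k+1≡ = trivial⇒multiplicity λ v A₀v≡0 → vanishing v A₀v≡0 (λ ()) (begin
  sum v                             ≡⟨ prefix-≥ v n ℕₚ.≤-refl ⟨
  prefix v (s ℕ.+ s ℕ.+ 0)          ≡⟨ cong (prefix v) (ℕₚ.+-identityʳ (s ℕ.+ s)) ⟩
  prefix v (s ℕ.+ s)                ≡⟨ P[m+c]≡P[m] v A₀v≡0 ⟩
  prefix v 0                        ≡⟨ prefix-zero v ⟩
  0ℚ                                ∎)
  where
  open TrivialKernel zero s k k+1≡
  open ≡-Reasoning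
multiplicity-blocks (suc m′) s k k+1≡ = go (mod3 m′)
  where
  open TrivialKernel (suc m′) s k k+1≡
  open ≡-Reasoning

  module _ (v : Vector ℚ n) (A₀v≡0 : Kernel (A₀ n k) v) where
    π[m-1]≡0 : π (prefix v 1) (sum v) m′ ≡ 0ℚ
    π[m-1]≡0 = trans (sym (proj₁ (P≡π v A₀v≡0 m′ ℕₚ.≤-refl))) (P[m-1]≡0 v A₀v≡0 refl)

    π[m]≡p : π (prefix v 1) (sum v) (suc m′) ≡ prefix v 1
    π[m]≡p = trans (sym (proj₂ (P≡π v A₀v≡0 m′ ℕₚ.≤-refl))) (sym (P1≡P[m] v A₀v≡0 (s≤s z≤n)))

  σ-p+p : ∀ {σ p} → p ≡ 0ℚ → σ - p ≡ 0ℚ → σ ≡ 0ℚ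
  σ-p+p {σ} refl e = trans (solve 1 (λ σ → σ := σ :- con 0ℚ) refl σ) e

  -- The residue is that of m - 1, so `3t` is the case m ≡ 1 mod 3. In the other cases π(m-1) = 0
  -- and π(m) = p leave no freedom: for m = 3t + 2 they read p = 0 and σ - p = p, for m = 3t + 3
  -- they read σ - p = 0 and 0 = p.
  go : Mod3 m′ → IsZeroOfMultiplicity (D n k) 0ℤ (N n k)
  go (3t t)   = NontrivialKernel.multiplicity t s k k+1≡
  go (3t+1 t) = trivial⇒multiplicity λ v A₀v≡0 →
    let p≡0 = trans (sym (π-3t+1 (prefix v 1) (sum v) t)) (π[m-1]≡0 v A₀v≡0)
        σ-p≡0 = trans (sym (π-3t+2 (prefix v 1) (sum v) t)) (trans (π[m]≡p v A₀v≡0) p≡0)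
    in vanishing v A₀v≡0 (λ _ → p≡0) (σ-p+p p≡0 σ-p≡0)
  go (3t+2 t) = trivial⇒multiplicity λ v A₀v≡0 →
    let σ-p≡0 = trans (sym (π-3t+2 (prefix v 1) (sum v) t)) (π[m-1]≡0 v A₀v≡0)
        p≡0 = trans (sym (π[m]≡p v A₀v≡0)) (π-3t (prefix v 1) (sum v) t)
    in vanishing v A₀v≡0 (λ _ → p≡0) (σ-p+p p≡0 σ-p≡0)

theorem9p2 : (ν k : ℕ) → 2 ℕ.* ν ∸ 1 ≥ k → k ≥ ν ∸ 1 → ν ∸ 1 ≥ 1 → IsZeroOfMultiplicity (D (2 ℕ.* ν) k) 0ℤ (N (2 ℕ.* ν) k)
theorem9p2 (suc ν′) k k≤2ν-1 ν-1≤k 1≤ν-1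
  -- The lower bound on k provides s = k + 1 - ν, and the upper bound gives s ≤ ν and hence m = ν -
  -- s. Then k + 1 = m + 2s and 2ν = 2m + 2s, so the middle block has length 2s.
  with s , ν+s≡k+1 ← ℕₚ.m≤n⇒∃[o]m+o≡n (s≤s ν-1≤k)
  with m , s+m≡ν ← ℕₚ.m≤n⇒∃[o]m+o≡n {s} {suc ν′} (ℕₚ.+-cancelˡ-≤ (suc ν′) s (suc ν′)
         (subst₂ _≤_ (sym ν+s≡k+1) (cong (suc ν′ ℕ.+_) (ℕₚ.+-identityʳ (suc ν′))) (s≤s k≤2ν-1)))
  = subst (λ n → IsZeroOfMultiplicity (D n k) 0ℤ (N n k)) n≡2ν (multiplicity-blocks m s k k+1≡)
  where
  ν = suc ν′

  k+1≡ : suc k ≡ m ℕ.+ (s ℕ.+ s)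
  k+1≡ = trans (sym ν+s≡k+1) (trans (cong (ℕ._+ s) (trans (sym s+m≡ν) (ℕₚ.+-comm s m))) (ℕₚ.+-assoc m s s))

  n≡2ν : m ℕ.+ (s ℕ.+ s) ℕ.+ m ≡ 2 ℕ.* ν
  n≡2ν = begin
    m ℕ.+ (s ℕ.+ s) ℕ.+ m      ≡⟨ cong (ℕ._+ m) (ℕₚ.+-assoc m s s) ⟨
    m ℕ.+ s ℕ.+ s ℕ.+ m        ≡⟨ ℕₚ.+-assoc (m ℕ.+ s) s m ⟩
    m ℕ.+ s ℕ.+ (s ℕ.+ m)      ≡⟨ cong₂ ℕ._+_ (trans (ℕₚ.+-comm m s) s+m≡ν) (trans s+m≡ν (sym (ℕₚ.+-identityʳ ν))) ⟩
    2 ℕ.* ν                    ∎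
    where open ≡-Reasoning
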